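{- Let $R$ be one of the chain rings $\mathbb{G}_4=\mathbb{Z}_4[X]/(X^2+X+1)$, $\mathbb{S}_4=\mathbb{F}_4[X]/(X^2)$, $\mathbb{T}_4=\mathbb{F}_4[X;a\mapsto a^2]/(X^2)$. Then $\mathrm{m}_5(R)\le 68$.
   Context: $\mathbb{F}_4[X;a\mapsto a^2]$ denotes the skew polynomial ring with commutation rule $Xa=a^2X$. For a finite chain ring $R$ of length $2$ with residue field $\mathbb{F}_q$, the projective Hjelmslev plane $\mathrm{PHG}(2,R)$ is the incidence structure whose points are the free rank-$1$ submodules of the right module $R_R^3$, whose lines are the free rank-$2$ submodules of $R_R^3$, with incidence given by inclusion. A projective $(k,n)$-arc is a set of $k$ points meeting every line in at most $n$ points. For $0\le n\le q^2+q$, $\mathrm{m}_n(R)$ denotes the largest $k$ such that a projective $(k,n)$-arc exists in $\mathrm{PHG}(2,R)$. -}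

module Defs where

open import Algebra.Bundles using (Ring; CommutativeRing; RawRing; AbelianGroup)
import Algebra.Construct.DirectProduct as DirectProduct
open import Algebra.Module.Bundles using (RightModule)
import Algebra.Module.Construct.DirectProduct as ModuleProduct
import Algebra.Module.Construct.TensorUnit as TensorUnit
open import Algebra.Morphism.Structures using (module RingMorphisms)
import Algebra.Properties.CommutativeMonoid.Sum as CommutativeMonoidSum
import Algebra.Properties.Monoid.Sum as MonoidSum
import Algebra.Solver.Ring.NaturalCoefficients.Default as SemiringSolver
open import Algebra.Structures using (IsCommutativeRing)
open import Data.Fin.Base using (Fin; zero; suc; toℕ)
import Data.Fin.Properties as Fin
open import Data.Fin.Subset using (Subset; _∈_; ∣_∣)
open import Data.Fin.Subset.Properties using (_∈?_; anySubset?)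
open import Data.List.Base using (List; length; lookup; cartesianProduct)
open import Data.List.Membership.Propositional.Properties using (∈-allFin)
import Data.List.Membership.Setoid as SetoidMembership
open import Data.List.Relation.Unary.Any as Any using (index)
open import Data.List.Relation.Unary.Any.Properties using (lookup-index)
open import Data.List.Relation.Unary.Enumerates.Setoid using (IsEnumeration)
open import Data.List.Relation.Unary.Enumerates.Setoid.Properties using (cartesianProduct⁺)
open import Data.Nat.Base using (ℕ; zero; suc; _≤_; z≤n; _∸_; NonZero)
import Data.Nat.Base as ℕ
open import Data.Nat.DivMod using (_mod_)
import Data.Nat.Properties as ℕ
open import Data.Product.Base using (∃; _×_; _,_; proj₁; proj₂; zip; map; swap)
open import Data.Product.Relation.Binary.Pointwise.NonDependent using (Pointwise; ×-decidable; _×ₛ_)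
open import Data.Vec.Base using ([])
open import Data.Vec.Functional using (Vector; _∷_; head; tail)
open import Function.Base using (id)
open import Level using (0ℓ; Setω) renaming (suc to lsuc)
open import Relation.Binary.Bundles using (Setoid)
open import Relation.Binary.Definitions using (Decidable; _Respects_)
import Relation.Binary.Reasoning.Setoid as SetoidReasoning
open import Relation.Binary.PropositionalEquality as ≡
  using (_≡_; cong; cong₂; isEquivalence)
open import Relation.Nullary.Decidable
  using (Dec; yes; no; map′; _×-dec_; _→-dec_; ¬?; from-yes; decidable-stable)
open import Relation.Unary using (Pred; _⊆_; _≐_) renaming (Decidable to Decidable₁)

module _ {c ℓ} (S : Setoid c ℓ) where
  open Setoid S
  open SetoidMembership S using (lose)

  -- Level-polymorphic, hence in Setω: submodules live in Set₁ and are searched too.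
  Searchable : Setω
  Searchable = ∀ {p} {P : Pred Carrier p} → P Respects _≈_ → Decidable₁ P → Dec (∃ P)

  enumeration⇒searchable : ∀ {xs} → IsEnumeration S xs → Searchable
  enumeration⇒searchable {xs} enum resp P? =
    map′ Any.satisfied (λ (x , px) → lose resp (enum x) px) (Any.any? P? xs)

  search⇒all : Searchable → ∀ {p} {P : Pred Carrier p} → P Respects _≈_ →
               Decidable₁ P → Dec (∀ x → P x)
  search⇒all search resp P? =
    map′ (λ ∄ x → decidable-stable (P? x) λ ¬px → ∄ (x , ¬px))
         (λ ∀p (x , ¬px) → ¬px (∀p x))
         (¬? (search (λ x≈y ¬px py → ¬px (resp (sym x≈y) py)) (λ x → ¬? (P? x))))

  pointwise : ℕ → Setoid c ℓ
  pointwise k = record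
    { Carrier = Vector Carrier k
    ; _≈_ = λ f g → ∀ i → f i ≈ g i
    ; isEquivalence = record
      { refl = λ _ → Setoid.refl S
      ; sym = λ e i → Setoid.sym S (e i)
      ; trans = λ e e′ i → Setoid.trans S (e i) (e′ i)
      }
    }

  vector-searchable : Searchable → ∀ k {p} {P : Pred (Vector Carrier k) p} →
                      P Respects (Setoid._≈_ (pointwise k)) → Decidable₁ P → Dec (∃ P)
  vector-searchable search zero resp P? =
    map′ (λ p → none , p) (λ (f , p) → resp (λ ()) p) (P? none)
    where
    none : Vector Carrier zero
    none ()
  vector-searchable search (suc k) resp P? =
    map′ (λ (x , f , p) → x ∷ f , p)
         (λ (f , p) → head f , tail f ,
            resp (λ { zero → Setoid.refl S ; (suc i) → Setoid.refl S }) p)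
         (search
           (λ x≈y (f , p) → f , resp (λ { zero → x≈y ; (suc i) → Setoid.refl S }) p)
           (λ x → vector-searchable search k
             (λ e → resp λ { zero → Setoid.refl S ; (suc i) → e i })
             (λ f → P? (x ∷ f))))

record FiniteRing : Set₁ where
  field
    ring : Ring 0ℓ 0ℓ
  open Ring ring public
  field
    _≟_ : Decidable _≈_
    elements : List Carrier
    enumerates : IsEnumeration setoid elements

ℤ/-raw : (n : ℕ) .{{_ : NonZero n}} → RawRing 0ℓ 0ℓ
ℤ/-raw n = record
  { Carrier = Fin n
  ; _≈_ = _≡_
  ; _+_ = λ i j → (toℕ i ℕ.+ toℕ j) mod n
  ; _*_ = λ i j → (toℕ i ℕ.* toℕ j) mod n
  ; -_ = λ i → (n ∸ toℕ i) mod n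
  ; 0# = 0 mod n
  ; 1# = 1 mod n
  }

module _ (n : ℕ) .{{_ : NonZero n}} where
  open RawRing (ℤ/-raw n) hiding (_≈_)

  ℤ/-isCommutativeRing? : Dec (IsCommutativeRing _≡_ _+_ _*_ -_ 0# 1#)
  ℤ/-isCommutativeRing? = map′
    (λ (+a , +c , +0 , +- , *a , *c , *1 , d) → record
      { isRing = record
        { +-isAbelianGroup = record
          { isGroup = record
            { isMonoid = record
              { isSemigroup = record
                { isMagma = record { isEquivalence = isEquivalence ; ∙-cong = cong₂ _+_ }
                ; assoc = +a
                }
              ; identity = (λ x → ≡.trans (+c 0# x) (+0 x)) , +0
              }
            ; inverse = (λ x → ≡.trans (+c (- x) x) (+- x)) , +-
            ; ⁻¹-cong = cong -_
            }
          ; comm = +c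
          }
        ; *-cong = cong₂ _*_
        ; *-assoc = *a
        ; *-identity = (λ x → ≡.trans (*c 1# x) (*1 x)) , *1
        ; distrib = d , λ x y z → ≡.trans (*c (y + z) x)
                          (≡.trans (d x y z) (cong₂ _+_ (*c x y) (*c x z)))
        }
      ; *-comm = *c
      })
    (λ r → let open IsCommutativeRing r in
      +-assoc , +-comm , +-identityʳ , -‿inverseʳ ,
      *-assoc , *-comm , *-identityʳ , distribˡ)
    ( (Fin.all? λ x → Fin.all? λ y → Fin.all? λ z → ((x + y) + z) Fin.≟ (x + (y + z)))
    ×-dec (Fin.all? λ x → Fin.all? λ y → (x + y) Fin.≟ (y + x))
    ×-dec (Fin.all? λ x → (x + 0#) Fin.≟ x)
    ×-dec (Fin.all? λ x → (x + (- x)) Fin.≟ 0#)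
    ×-dec (Fin.all? λ x → Fin.all? λ y → Fin.all? λ z → ((x * y) * z) Fin.≟ (x * (y * z)))
    ×-dec (Fin.all? λ x → Fin.all? λ y → (x * y) Fin.≟ (y * x))
    ×-dec (Fin.all? λ x → (x * 1#) Fin.≟ x)
    ×-dec (Fin.all? λ x → Fin.all? λ y → Fin.all? λ z →
             (x * (y + z)) Fin.≟ ((x * y) + (x * z))))

ℤ/2 ℤ/4 : CommutativeRing 0ℓ 0ℓ
ℤ/2 = record { isCommutativeRing = from-yes (ℤ/-isCommutativeRing? 2) }
ℤ/4 = record { isCommutativeRing = from-yes (ℤ/-isCommutativeRing? 4) }

-- A[X]/(X² + pX + q): the pair (a , b) stands for the class of a + bX, a unique
-- representative since X² + pX + q is monic.  Multiplication uses X² = -q - pX.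
module _ {c ℓ} (A : CommutativeRing c ℓ) where
  private
    module A = CommutativeRing A
    module A×A = AbelianGroup (DirectProduct.abelianGroup A.+-abelianGroup A.+-abelianGroup)
  open A using (_+_; _*_; -_; 0#; 1#)
  open SemiringSolver A.commutativeSemiring using (solve; _:=_; _:+_; _:*_)

  quadraticExtension : (p q : A.Carrier) → CommutativeRing c ℓ
  quadraticExtension p q = record
    { Carrier = A.Carrier × A.Carrier
    ; _≈_ = Pointwise A._≈_ A._≈_
    ; _+_ = zip _+_ _+_
    ; _*_ = _·_
    ; -_ = map -_ -_
    ; 0# = 0# , 0#
    ; 1# = 1# , 0#
    ; isCommutativeRing = record
      { isRing = record
        { +-isAbelianGroup = A×A.isAbelianGroup
        ; *-cong = ·-cong
        ; *-assoc = ·-assoc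
        ; *-identity = ·-identityˡ , λ x → A×A.trans (·-comm x _) (·-identityˡ x)
        ; distrib = ·-distribˡ ,
            λ x y z → A×A.trans (·-comm _ x)
              (A×A.trans (·-distribˡ x y z) (A×A.∙-cong (·-comm x y) (·-comm x z)))
        }
      ; *-comm = ·-comm
      }
    }
    where
    _·_ : A×A.Carrier → A×A.Carrier → A×A.Carrier
    (a , b) · (c , d) =
      a * c + (- q) * (b * d) , (a * d + b * c) + (- p) * (b * d)

    ·-cong : ∀ {x y u v} → x A×A.≈ y → u A×A.≈ v → (x · u) A×A.≈ (y · v)
    ·-cong (e , f) (g , h) =
      A.+-cong (A.*-cong e g) (A.*-congˡ (A.*-cong f h)) ,
      A.+-cong (A.+-cong (A.*-cong e h) (A.*-cong f g)) (A.*-congˡ (A.*-cong f h))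

    ·-comm : ∀ x y → (x · y) A×A.≈ (y · x)
    ·-comm (a , b) (c , d) =
      solve 5 (λ q a b c d → a :* c :+ q :* (b :* d) := c :* a :+ q :* (d :* b))
        A.refl (- q) a b c d ,
      solve 5 (λ p a b c d → (a :* d :+ b :* c) :+ p :* (b :* d)
                          := (c :* b :+ d :* a) :+ p :* (d :* b))
        A.refl (- p) a b c d

    ·-assoc : ∀ x y z → ((x · y) · z) A×A.≈ (x · (y · z))
    ·-assoc (a , b) (c , d) (e , f) =
      solve 8 (λ p q a b c d e f →
          (a :* c :+ q :* (b :* d)) :* e
            :+ q :* (((a :* d :+ b :* c) :+ p :* (b :* d)) :* f)
          := a :* (c :* e :+ q :* (d :* f))
            :+ q :* (b :* ((c :* f :+ d :* e) :+ p :* (d :* f))))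
        A.refl (- p) (- q) a b c d e f ,
      solve 8 (λ p q a b c d e f →
          ((a :* c :+ q :* (b :* d)) :* f
            :+ ((a :* d :+ b :* c) :+ p :* (b :* d)) :* e)
            :+ p :* (((a :* d :+ b :* c) :+ p :* (b :* d)) :* f)
          := (a :* ((c :* f :+ d :* e) :+ p :* (d :* f))
            :+ b :* (c :* e :+ q :* (d :* f)))
            :+ p :* (b :* ((c :* f :+ d :* e) :+ p :* (d :* f))))
        A.refl (- p) (- q) a b c d e f

    ·-identityˡ : ∀ x → ((1# , 0#) · x) A×A.≈ x
    ·-identityˡ (a , b) =
      A.trans (A.+-cong (A.*-identityˡ a) (zeroed (- q))) (A.+-identityʳ a) ,
      A.trans (A.+-cong (A.+-cong (A.*-identityˡ b) (A.zeroˡ a)) (zeroed (- p)))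
        (A.trans (A.+-identityʳ _) (A.+-identityʳ b))
      where
      zeroed : ∀ r → r * (0# * b) A.≈ 0#
      zeroed r = A.trans (A.*-congˡ (A.zeroˡ b)) (A.zeroʳ r)

    ·-distribˡ : ∀ x y z → (x · zip _+_ _+_ y z) A×A.≈ zip _+_ _+_ (x · y) (x · z)
    ·-distribˡ (a , b) (c , d) (e , f) =
      solve 7 (λ q a b c d e f →
          a :* (c :+ e) :+ q :* (b :* (d :+ f))
          := (a :* c :+ q :* (b :* d)) :+ (a :* e :+ q :* (b :* f)))
        A.refl (- q) a b c d e f ,
      solve 7 (λ p a b c d e f →
          (a :* (d :+ f) :+ b :* (c :+ e)) :+ p :* (b :* (d :+ f))
          := ((a :* d :+ b :* c) :+ p :* (b :* d)) :+ ((a :* f :+ b :* e) :+ p :* (b :* f)))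
        A.refl (- p) a b c d e f

-- A[X;σ]/(X²) with commutation rule X a = σ(a) X: the pair (a , b) stands for the
-- class of a + bX.
module _ {c ℓ} (A : Ring c ℓ) where
  private
    module A = Ring A
    module A×A = AbelianGroup (DirectProduct.abelianGroup A.+-abelianGroup A.+-abelianGroup)
  open A using (_+_; _*_; -_; 0#; 1#)
  open RingMorphisms A.rawRing A.rawRing using (IsRingHomomorphism)
  open SetoidReasoning A.setoid

  skewDualNumbers : (σ : A.Carrier → A.Carrier) → IsRingHomomorphism σ → Ring c ℓ
  skewDualNumbers σ isHom = record
    { Carrier = A.Carrier × A.Carrier
    ; _≈_ = Pointwise A._≈_ A._≈_
    ; _+_ = zip _+_ _+_
    ; _*_ = _·_
    ; -_ = map -_ -_
    ; 0# = 0# , 0#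
    ; 1# = 1# , 0#
    ; isRing = record
      { +-isAbelianGroup = A×A.isAbelianGroup
      ; *-cong = λ (e , f) (g , h) →
          A.*-cong e g , A.+-cong (A.*-cong e h) (A.*-cong f (σ.⟦⟧-cong g))
      ; *-assoc = λ (a , b) (c , d) (e , f) → A.*-assoc a c e , assoc a b c d e f
      ; *-identity =
          (λ (a , b) → A.*-identityˡ a ,
            A.trans (A.+-cong (A.*-identityˡ b) (A.zeroˡ _)) (A.+-identityʳ b)) ,
          (λ (a , b) → A.*-identityʳ a ,
            A.trans
              (A.+-cong (A.zeroʳ a) (A.trans (A.*-congˡ σ.1#-homo) (A.*-identityʳ b)))
              (A.+-identityˡ b))
      ; distrib =
          (λ (a , b) (c , d) (e , f) → A.distribˡ a c e ,
            A.trans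
              (A.+-cong (A.distribˡ a d f)
                (A.trans (A.*-congˡ (σ.+-homo c e)) (A.distribˡ b (σ c) (σ e))))
              (interchange (a * d) (a * f) (b * σ c) (b * σ e))) ,
          (λ (a , b) (c , d) (e , f) → A.distribʳ a c e ,
            A.trans (A.+-cong (A.distribʳ b c e) (A.distribʳ (σ a) d f))
              (interchange (c * b) (e * b) (d * σ a) (f * σ a)))
      }
    }
    where
    module σ = IsRingHomomorphism isHom

    _·_ : A×A.Carrier → A×A.Carrier → A×A.Carrier
    (a , b) · (c , d) = a * c , a * d + b * σ c

    interchange : ∀ w x y z → (w + x) + (y + z) A.≈ (w + y) + (x + z)
    interchange w x y z = begin
      (w + x) + (y + z) ≈⟨ A.+-assoc w x (y + z) ⟩
      w + (x + (y + z)) ≈⟨ A.+-congˡ (A.+-assoc x y z) ⟨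
      w + ((x + y) + z) ≈⟨ A.+-congˡ (A.+-congʳ (A.+-comm x y)) ⟩
      w + ((y + x) + z) ≈⟨ A.+-congˡ (A.+-assoc y x z) ⟩
      w + (y + (x + z)) ≈⟨ A.+-assoc w y (x + z) ⟨
      (w + y) + (x + z) ∎

    assoc : ∀ a b c d e f →
            (a * c) * f + (a * d + b * σ c) * σ e A.≈ a * (c * f + d * σ e) + b * σ (c * e)
    assoc a b c d e f = begin
      (a * c) * f + (a * d + b * σ c) * σ e
        ≈⟨ A.+-cong (A.*-assoc a c f) (A.distribʳ (σ e) (a * d) (b * σ c)) ⟩
      a * (c * f) + ((a * d) * σ e + (b * σ c) * σ e)
        ≈⟨ A.+-congˡ (A.+-cong (A.*-assoc a d (σ e)) (A.*-assoc b (σ c) (σ e))) ⟩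
      a * (c * f) + (a * (d * σ e) + b * (σ c * σ e))
        ≈⟨ A.+-assoc _ _ _ ⟨
      (a * (c * f) + a * (d * σ e)) + b * (σ c * σ e)
        ≈⟨ A.+-cong (A.distribˡ a _ _) (A.*-congˡ (σ.*-homo c e)) ⟨
      a * (c * f + d * σ e) + b * σ (c * e) ∎

private
  module ℤ/2 = CommutativeRing ℤ/2
  module ℤ/4 = CommutativeRing ℤ/4

F₄ : CommutativeRing 0ℓ 0ℓ
F₄ = quadraticExtension ℤ/2 ℤ/2.1# ℤ/2.1#

private
  module F₄ = CommutativeRing F₄

  _≟²_ : ∀ {n} → Decidable (Pointwise {A = Fin n} {C = Fin n} _≡_ _≡_)
  _≟²_ = ×-decidable Fin._≟_ Fin._≟_

  all²? : ∀ {m n} {P : Pred (Fin m × Fin n) 0ℓ} → Decidable₁ P → Dec (∀ x → P x)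
  all²? P? = map′ (λ f (i , j) → f i j) (λ f i j → f (i , j))
                  (Fin.all? λ i → Fin.all? λ j → P? (i , j))

  squares : ∀ {c ℓ} (S : Setoid c ℓ) {xs} → IsEnumeration S xs →
            IsEnumeration (S ×ₛ S) (cartesianProduct xs xs)
  squares S enum = cartesianProduct⁺ S S enum enum

frobenius : F₄.Carrier → F₄.Carrier
frobenius a = a F₄.* a

open RingMorphisms F₄.rawRing F₄.rawRing using (IsRingHomomorphism)

frobenius-isRingHomomorphism : IsRingHomomorphism frobenius
frobenius-isRingHomomorphism = record
  { isSemiringHomomorphism = record
    { isNearSemiringHomomorphism = record
      { +-isMonoidHomomorphism = record
        { isMagmaHomomorphism = record
          { isRelHomomorphism = record { cong = λ x≈y → F₄.*-cong x≈y x≈y }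
          ; homo = from-yes (all²? λ x → all²? λ y →
              frobenius (x F₄.+ y) ≟² (frobenius x F₄.+ frobenius y))
          }
        ; ε-homo = F₄.zeroˡ F₄.0#
        }
      ; *-homo = from-yes (all²? λ x → all²? λ y →
          frobenius (x F₄.* y) ≟² (frobenius x F₄.* frobenius y))
      }
    ; 1#-homo = F₄.*-identityˡ F₄.1#
    }
  ; -‿homo = from-yes (all²? λ x → frobenius (F₄.- x) ≟² (F₄.- frobenius x))
  }

-- ℤ₄[X]/(X² + X + 1), F₄[X]/(X²) and F₄[X; a ↦ a²]/(X²)
𝔾₄ 𝕊₄ 𝕋₄ : FiniteRing
𝔾₄ = record
  { ring = CommutativeRing.ring (quadraticExtension ℤ/4 ℤ/4.1# ℤ/4.1#)
  ; _≟_ = _≟²_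
  ; enumerates = squares ℤ/4.setoid ∈-allFin
  }
𝕊₄ = record
  { ring = CommutativeRing.ring (quadraticExtension F₄ F₄.0# F₄.0#)
  ; _≟_ = ×-decidable _≟²_ _≟²_
  ; enumerates = squares F₄.setoid (squares ℤ/2.setoid ∈-allFin)
  }
𝕋₄ = record
  { ring = skewDualNumbers F₄.ring frobenius frobenius-isRingHomomorphism
  ; _≟_ = ×-decidable _≟²_ _≟²_
  ; enumerates = squares F₄.setoid (squares ℤ/2.setoid ∈-allFin)
  }

module Submodules {R : Ring 0ℓ 0ℓ} (M : RightModule R 0ℓ 0ℓ) where
  private
    module R = Ring R
  open RightModule M
  open MonoidSum +ᴹ-monoid using (sum)

  combination : ∀ {k} → Vector Carrierᴹ k → Vector R.Carrier k → Carrierᴹ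
  combination b r = sum λ i → b i *ᵣ r i

  span : ∀ {k} → Vector Carrierᴹ k → Pred Carrierᴹ 0ℓ
  span b v = ∃ λ r → v ≈ᴹ combination b r

  LinearlyIndependent : ∀ {k} → Vector Carrierᴹ k → Set
  LinearlyIndependent b = ∀ r → combination b r ≈ᴹ 0ᴹ → ∀ i → r i R.≈ R.0#

  record Submodule : Set₁ where
    field
      members : Pred Carrierᴹ 0ℓ
      respects : members Respects _≈ᴹ_
      0ᴹ-closed : members 0ᴹ
      +ᴹ-closed : ∀ {u v} → members u → members v → members (u +ᴹ v)
      *ᵣ-closed : ∀ {v} r → members v → members (v *ᵣ r)

  record IsFreeOfRank (k : ℕ) (N : Submodule) : Set where
    field
      basis : Vector Carrierᴹ k
      independent : LinearlyIndependent basis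
      spanning : Submodule.members N ≐ span basis

  FreeSubmodule : ℕ → Set₁
  FreeSubmodule k = ∃ (IsFreeOfRank k)

  ⟦_⟧ : ∀ {k} → FreeSubmodule k → Pred Carrierᴹ 0ℓ
  ⟦ N , _ ⟧ = Submodule.members N

module PHG (R : Ring 0ℓ 0ℓ) where

  R³ : RightModule R 0ℓ 0ℓ
  R³ = ModuleProduct.rightModule R₁ (ModuleProduct.rightModule R₁ R₁)
    where
    R₁ : RightModule R 0ℓ 0ℓ
    R₁ = TensorUnit.rightModule

  open Submodules R³ public

  Point Line : Set₁
  Point = FreeSubmodule 1
  Line = FreeSubmodule 2

  -- K lists k pairwise distinct points; as a submodule, a point is determined by its
  -- members.  The second field says that every set S of indices of points on L has at
  -- most n elements.
  record IsProjectiveArc {k : ℕ} (n : ℕ) (K : Vector Point k) : Set₁ where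
    field
      distinct : ∀ i j → ⟦ K i ⟧ ≐ ⟦ K j ⟧ → i ≡ j
      meets : ∀ (L : Line) (S : Subset k) → (∀ i → i ∈ S → ⟦ K i ⟧ ⊆ ⟦ L ⟧) → ∣ S ∣ ≤ n

  ProjectiveArc : ℕ → ℕ → Set₁
  ProjectiveArc k n = ∃ λ (K : Vector Point k) → IsProjectiveArc n K

IsLargest : ∀ {p} → Pred ℕ p → ℕ → Set p
IsLargest P m = P m × (∀ k → P k → k ≤ m)

-- Over a finite ring all of the above is decidable, so a largest arc exists.
module ArcSearch (R : FiniteRing) where
  private
    module R = FiniteRing R
  open PHG R.ring
  open RightModule R³
  open CommutativeMonoidSum +ᴹ-commutativeMonoid using (∑-distrib-+; sum-cong-≋)

  vectors : List Carrierᴹ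
  vectors = cartesianProduct R.elements (cartesianProduct R.elements R.elements)

  vectors-enum : IsEnumeration ≈ᴹ-setoid vectors
  vectors-enum = cartesianProduct⁺ R.setoid (R.setoid ×ₛ R.setoid) R.enumerates
                   (cartesianProduct⁺ R.setoid R.setoid R.enumerates R.enumerates)

  search-R : Searchable R.setoid
  search-R = enumeration⇒searchable R.setoid R.enumerates

  search-R³ : Searchable ≈ᴹ-setoid
  search-R³ = enumeration⇒searchable ≈ᴹ-setoid vectors-enum

  _≟ᴹ_ : Decidable _≈ᴹ_
  _≟ᴹ_ = ×-decidable R._≟_ (×-decidable R._≟_ R._≟_)

  combination-cong : ∀ {k} {b c : Vector Carrierᴹ k} {r s} →
                     (∀ i → b i ≈ᴹ c i) → (∀ i → r i R.≈ s i) →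
                     combination b r ≈ᴹ combination c s
  combination-cong e f = sum-cong-≋ λ i → *ᵣ-cong (e i) (f i)

  span-resp : ∀ {k} (b : Vector Carrierᴹ k) → span b Respects _≈ᴹ_
  span-resp b e (r , p) = r , ≈ᴹ-trans (≈ᴹ-sym e) p

  span-cong : ∀ {k} {b c : Vector Carrierᴹ k} → (∀ i → b i ≈ᴹ c i) → span b ⊆ span c
  span-cong e (r , p) = r , ≈ᴹ-trans p (combination-cong e λ _ → R.refl)

  combination-*ᵣ : ∀ {k} (b : Vector Carrierᴹ k) r s →
                   combination b r *ᵣ s ≈ᴹ combination b (λ i → r i R.* s)
  combination-*ᵣ {zero} b r s = *ᵣ-zeroˡ s
  combination-*ᵣ {suc k} b r s = ≈ᴹ-trans (*ᵣ-distribʳ s _ _)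
    (+ᴹ-cong (*ᵣ-assoc _ _ s) (combination-*ᵣ (tail b) (tail r) s))

  combination-0 : ∀ {k} (b : Vector Carrierᴹ k) → combination b (λ _ → R.0#) ≈ᴹ 0ᴹ
  combination-0 {zero} b = ≈ᴹ-refl
  combination-0 {suc k} b = ≈ᴹ-trans
    (+ᴹ-cong (*ᵣ-zeroʳ _) (combination-0 (tail b))) (+ᴹ-identityʳ _)

  spanned : ∀ {k} (b : Vector Carrierᴹ k) → LinearlyIndependent b → FreeSubmodule k
  spanned b li = record
    { members = span b
    ; respects = span-resp b
    ; 0ᴹ-closed = (λ _ → R.0#) , ≈ᴹ-sym (combination-0 b)
    ; +ᴹ-closed = λ (r , p) (s , q) → (λ i → r i R.+ s i) ,
        ≈ᴹ-trans (+ᴹ-cong p q) (≈ᴹ-trans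
          (≈ᴹ-sym (∑-distrib-+ (λ i → b i *ᵣ r i) (λ i → b i *ᵣ s i)))
          (sum-cong-≋ λ i → ≈ᴹ-sym (*ᵣ-distribˡ (b i) (r i) (s i))))
    ; *ᵣ-closed = λ s (r , p) → (λ i → r i R.* s) ,
        ≈ᴹ-trans (*ᵣ-cong p R.refl) (combination-*ᵣ b r s)
    } , record { basis = b ; independent = li ; spanning = id , id }

  freeSubmodules : ℕ → Setoid (lsuc 0ℓ) 0ℓ
  freeSubmodules k = record
    { Carrier = FreeSubmodule k
    ; _≈_ = λ N N′ → ⟦ N ⟧ ≐ ⟦ N′ ⟧
    ; isEquivalence = record
      { refl = id , id
      ; sym = swap
      ; trans = λ (f , g) (f′ , g′) → (λ x → f′ (f x)) , (λ x → g (g′ x))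
      }
    }

  independent-resp : ∀ {k} → LinearlyIndependent {k} Respects Setoid._≈_ (pointwise ≈ᴹ-setoid k)
  independent-resp e li r p = li r (≈ᴹ-trans (combination-cong e λ _ → R.refl) p)

  independent? : ∀ {k} → Decidable₁ (LinearlyIndependent {k})
  independent? {k} b = search⇒all (pointwise R.setoid k) (vector-searchable R.setoid search-R k)
    (λ e f p i → R.trans (R.sym (e i)) (f (≈ᴹ-trans (combination-cong (λ _ → ≈ᴹ-refl) e) p) i))
    (λ r → (combination b r ≟ᴹ 0ᴹ) →-dec Fin.all? (λ i → r i R.≟ R.0#))

  search-free : ∀ k → Searchable (freeSubmodules k)
  search-free k {P = P} resp P? = map′
    (λ (b , li , p) → spanned b li , p)
    (λ (N , p) → let open IsFreeOfRank (proj₂ N) in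
      basis , independent , resp {N} {spanned basis independent} spanning p)
    (vector-searchable ≈ᴹ-setoid search-R³ k {P = λ b → ∃ λ li → P (spanned b li)}
      (λ {b} {c} e (li , p) → independent-resp e li ,
        resp {spanned b li} {spanned c (independent-resp e li)}
          (span-cong e , span-cong (λ i → ≈ᴹ-sym (e i))) p)
      decide)
    where
    decide : ∀ b → Dec (∃ λ li → P (spanned b li))
    decide b with independent? b
    ... | no ¬li = no λ (li , _) → ¬li li
    ... | yes li = map′ (li ,_)
      (λ (li′ , p) → resp {spanned b li′} {spanned b li} (id , id) p) (P? (spanned b li))

  member? : ∀ {k} (N : FreeSubmodule k) → Decidable₁ ⟦ N ⟧
  member? {k} (N , free) v = map′ (proj₂ spanning) (proj₁ spanning)
    (vector-searchable R.setoid search-R k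
      (λ e p → ≈ᴹ-trans p (combination-cong (λ _ → ≈ᴹ-refl) e))
      (λ r → v ≟ᴹ combination basis r))
    where open IsFreeOfRank free

  _⊆?_ : ∀ {k l} (N : FreeSubmodule k) (N′ : FreeSubmodule l) → Dec (⟦ N ⟧ ⊆ ⟦ N′ ⟧)
  N ⊆? N′ = map′ (λ f {v} → f v) (λ f v → f)
    (search⇒all ≈ᴹ-setoid search-R³
      (λ e f p → Submodule.respects (proj₁ N′) e
                   (f (Submodule.respects (proj₁ N) (≈ᴹ-sym e) p)))
      (λ v → member? N v →-dec member? N′ v))

  isProjectiveArc-resp : ∀ {k n} → IsProjectiveArc {k} n Respects
                         Setoid._≈_ (pointwise (freeSubmodules 1) k)
  isProjectiveArc-resp e arc = record
    { distinct = λ i j (f , g) → distinct i j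
        ( (λ x → proj₂ (e j) (f (proj₁ (e i) x)))
        , (λ x → proj₂ (e i) (g (proj₁ (e j) x))))
    ; meets = λ L S on → meets L S λ i i∈S x → on i i∈S (proj₁ (e i) x)
    }
    where open IsProjectiveArc arc

  isProjectiveArc? : ∀ {k} n → Decidable₁ (IsProjectiveArc {k} n)
  isProjectiveArc? {k} n K = map′
    (λ (d , m) → record { distinct = d ; meets = m })
    (λ a → IsProjectiveArc.distinct a , IsProjectiveArc.meets a)
    ( (Fin.all? λ i → Fin.all? λ j →
        ((K i ⊆? K j) ×-dec (K j ⊆? K i)) →-dec (i Fin.≟ j))
    ×-dec
      search⇒all (freeSubmodules 2) (search-free 2)
        (λ (f , g) m S on → m S λ i i∈S x → g (on i i∈S x))
        (λ L → all-subsets? λ S →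
          (Fin.all? λ i → (i ∈? S) →-dec (K i ⊆? L)) →-dec (∣ S ∣ ℕ.≤? n)))
    where
    all-subsets? : ∀ {P : Pred (Subset k) 0ℓ} → Decidable₁ P → Dec (∀ S → P S)
    all-subsets? P? =
      map′ (λ ∄ S → decidable-stable (P? S) λ ¬p → ∄ (S , ¬p)) (λ ∀p (S , ¬p) → ¬p (∀p S))
           (¬? (anySubset? λ S → ¬? (P? S)))

  projectiveArc? : ∀ n → Decidable₁ (λ k → ProjectiveArc k n)
  projectiveArc? n k = vector-searchable (freeSubmodules 1) (search-free 1) k
                         isProjectiveArc-resp (isProjectiveArc? n)

  emptyArc : ∀ n → ProjectiveArc 0 n
  emptyArc n = (λ ()) , record { distinct = λ () ; meets = λ { L [] _ → z≤n } }

  arc-bound : ∀ {n} k → ProjectiveArc k n → k ≤ length vectors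
  arc-bound k (K , arc) = Fin.injective⇒≤ {f = code} λ {i} {j} eq →
    IsProjectiveArc.distinct arc i j (sub eq , sub (≡.sym eq))
    where
    module K i = IsFreeOfRank (proj₂ (K i))

    code : Fin k → Fin (length vectors)
    code i = index (vectors-enum (K.basis i zero))

    sub : ∀ {i j} → code i ≡ code j → ⟦ K i ⟧ ⊆ ⟦ K j ⟧
    sub {i} {j} eq x = proj₂ (K.spanning j) (span-cong same (proj₁ (K.spanning i) x))
      where
      same : ∀ l → K.basis i l ≈ᴹ K.basis j l
      same zero = ≈ᴹ-trans (lookup-index (vectors-enum (K.basis i zero)))
        (≈ᴹ-trans (≈ᴹ-reflexive (cong (lookup vectors) eq))
          (≈ᴹ-sym (lookup-index (vectors-enum (K.basis j zero)))))

  bounded-search : ∀ {p} {P : Pred ℕ p} → Decidable₁ P → P 0 →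
                   ∀ N → (∀ k → P k → k ≤ N) → ∃ (IsLargest P)
  bounded-search P? p₀ zero bound = 0 , p₀ , bound
  bounded-search P? p₀ (suc N) bound with P? (suc N)
  ... | yes p = suc N , p , bound
  ... | no ¬p = bounded-search P? p₀ N λ k pk →
    ℕ.s≤s⁻¹ (ℕ.≤∧≢⇒< (bound k pk) λ { ≡.refl → ¬p pk })

  -- Opaque to keep the exhaustive search from being unfolded; the type determines the
  -- value.
  opaque
    largestArc : ∀ n → ∃ (IsLargest (λ k → ProjectiveArc k n))
    largestArc n = bounded-search (projectiveArc? n) (emptyArc n) (length vectors) arc-bound

-- The maximal number of points of a projective (k , n)-arc in PHG(2, R).
m : ℕ → FiniteRing → ℕ
m n R = proj₁ (ArcSearch.largestArc R n)

{-# OPTIONS --safe #-}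
module Submission where

-- Let K be a (69,5)-arc, or even a multiset of 69 points meeting every line in at most 5.
-- The 21 neighbour classes of points form PG(2,4), and each is an affine plane of order 4
-- whose lines are the segments cut out by the lines of the Hjelmslev plane.  The four
-- lines through a segment that belong to a fixed line class partition the other 64 points
-- of that class, so a segment with many points of K makes the rest of the class poor.
-- Counting this way, every point class has w ≤ 4 points of K.  Put δ = 4 - w, so that Σδ
-- = 15, and let D(ℓ) be the sum of δ over the five points of the line ℓ of PG(2,4).
-- A class with δ = 0 either is a segment, and then lies on a line with D ≥ 12, or meets
-- exactly three directions in a 2+2 pattern, and then lies on three lines with D ≥ 4.
-- Counting points of K on the 16 lines of a line class up to second moments shows that
-- D = 4 never occurs.  Hence the lines through a class of the second kind have
-- D = 5, 5, 5, 0, 0, and in the pencil of a suitable point z with δ(z) > 0 four lines, or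
-- all five, have D = 5.  This contradicts the pencil sum 15 + 4δ(z).

open import Algebra.Bundles using (CommutativeRing)
open import Algebra.Module.Bundles using (RightModule)
import Algebra.Properties.Group as GroupProperties
import Algebra.Properties.Ring as RingProperties
import Algebra.Properties.Semiring.Sum as SemiringSum
import Algebra.Solver.CommutativeMonoid as CommutativeMonoidSolver
open import Data.Bool.Base using (true; false; if_then_else_)
open import Data.Empty using (⊥; ⊥-elim)
open import Data.Fin.Base using (Fin; zero; suc; toℕ; remQuot)
open import Data.Fin.Patterns using (0F; 1F; 2F; 3F)
import Data.Fin.Properties as Fin
open import Data.Fin.Subset using (Subset; _∈_; ∣_∣; outside)
import Data.Nat.Base as ℕ
open import Data.Nat.Base using (ℕ; zero; suc; _≤_; _<_; z≤n; s≤s; s≤s⁻¹)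
open import Data.Nat.Divisibility using (_∣_; _∣?_; _∣0; ∣-refl; ∣m∣n⇒∣m+n)
open import Data.Nat.DivMod using (_mod_)
import Data.Nat.Properties as ℕ
open import Data.Nat.Tactic.RingSolver using (solve-∀)
open import Data.Product.Base using (∃; ∃₂; _×_; _,_; proj₁; proj₂)
open import Data.Sum.Base using (_⊎_; inj₁; inj₂)
import Data.Vec.Base as Vec
open import Data.Vec.Base using (Vec; []; _∷_; lookup; tabulate; insertAt)
open import Data.Vec.Functional using (Vector)
import Data.Vec.Properties as Vec
open import Defs
  using (FiniteRing; F₄; 𝔾₄; 𝕊₄; 𝕋₄; m; search⇒all; enumeration⇒searchable; module PHG; module ArcSearch)
open import Function.Base using (id)
import Relation.Binary.PropositionalEquality as ≡
open import Relation.Binary.PropositionalEquality using (_≡_; _≢_; cong; cong₂; subst; subst₂)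
open import Relation.Nullary.Decidable
  using (Dec; yes; no; does; dec-true; dec-false; from-yes; from-no; map′; ¬?; _→-dec_; _×-dec_; _⊎-dec_)
open import Relation.Nullary.Negation using (¬_; contradiction)
open import Relation.Unary using (_⊆_)

open SemiringSum ℕ.+-*-semiring
  using (sum; sum-syntax; sum-cong-≗; ∑-distrib-+; ∑-comm; *-distribˡ-sum; *-distribʳ-sum)

module Combinatorics where
  open import Data.Nat.Base using (_+_; _*_; _∸_)
  open import Relation.Binary.PropositionalEquality using (refl; sym; trans; module ≡-Reasoning)

  -- Finite sums

  -- Linear arithmetic by certificates: in every use the equation is a semiring identity.
  linear : ∀ {L R x y} k → L ≤ R → x + R + k ≡ y + L → x ≤ y
  linear {L} {R} {x} {y} k L≤R e = ℕ.+-cancelʳ-≤ L x y (begin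
    x + L      ≤⟨ ℕ.+-monoʳ-≤ x L≤R ⟩
    x + R      ≤⟨ ℕ.m≤m+n (x + R) k ⟩
    x + R + k  ≡⟨ e ⟩
    y + L      ∎)
    where open ℕ.≤-Reasoning

  infixr 5 _+≤_
  _+≤_ : ∀ {a b c d} → a ≤ b → c ≤ d → a + c ≤ b + d
  _+≤_ = ℕ.+-mono-≤

  infixr 7 _*≤_
  _*≤_ : ∀ k {a b} → a ≤ b → k * a ≤ k * b
  _*≤_ k = ℕ.*-monoʳ-≤ k

  sum-mono : ∀ {n} {f g : Vector ℕ n} → (∀ i → f i ≤ g i) → sum f ≤ sum g
  sum-mono {zero}  f≤g = z≤n
  sum-mono {suc n} f≤g = ℕ.+-mono-≤ (f≤g zero) (sum-mono λ i → f≤g (suc i))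

  term≤sum : ∀ {n} (f : Vector ℕ n) i → f i ≤ sum f
  term≤sum f zero    = ℕ.m≤m+n _ _
  term≤sum f (suc i) = ℕ.≤-trans (term≤sum (λ j → f (suc j)) i) (ℕ.m≤n+m _ (f zero))

  sum-const : ∀ n k → ∑[ i < n ] k ≡ n * k
  sum-const zero    k = refl
  sum-const (suc n) k = cong (k +_) (sum-const n k)

  sum-even : ∀ {n} (f : Vector ℕ n) → (∀ i → 2 ∣ f i) → 2 ∣ sum f
  sum-even {zero}  f even = 2 ∣0
  sum-even {suc n} f even = ∣m∣n⇒∣m+n (even zero) (sum-even (λ i → f (suc i)) λ i → even (suc i))

  sum-tight : ∀ {n} {f g : Vector ℕ n} → (∀ i → f i ≤ g i) → sum g ≤ sum f → ∀ i → f i ≡ g i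
  sum-tight {suc n} {f} {g} f≤g Σg≤Σf zero = ℕ.≤-antisym (f≤g zero)
    (linear 0 (Σg≤Σf +≤ sum-mono λ i → f≤g (suc i))
      (rearranged (f zero) (g zero) (sum λ i → f (suc i)) (sum λ i → g (suc i))))
    where
    rearranged : ∀ a b s t → b + (a + s + t) + 0 ≡ a + (b + t + s)
    rearranged = solve-∀
  sum-tight {suc n} {f} {g} f≤g Σg≤Σf (suc i) = sum-tight (λ i → f≤g (suc i))
    (linear 0 (Σg≤Σf +≤ f≤g zero) (rearranged (f zero) (g zero) (sum λ i → f (suc i)) (sum λ i → g (suc i)))) i
    where
    rearranged : ∀ a b s t → t + (a + s + b) + 0 ≡ s + (b + t + a)
    rearranged = solve-∀

  eq : ∀ {n} → Fin n → Fin n → ℕ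
  eq i j = if does (i Fin.≟ j) then 1 else 0

  eq-refl : ∀ {n} (i : Fin n) → eq i i ≡ 1
  eq-refl i rewrite dec-true (i Fin.≟ i) refl = refl

  eq-≢ : ∀ {n} {i j : Fin n} → i ≢ j → eq i j ≡ 0
  eq-≢ {i = i} {j} i≢j rewrite dec-false (i Fin.≟ j) i≢j = refl

  eq≡1⇒≡ : ∀ {n} {i j : Fin n} → eq i j ≡ 1 → i ≡ j
  eq≡1⇒≡ {i = i} {j} e with i Fin.≟ j
  ... | yes i≡j = i≡j

  eq-sym : ∀ {n} (i j : Fin n) → eq i j ≡ eq j i
  eq-sym i j with i Fin.≟ j
  ... | yes refl = sym (eq-refl i)
  ... | no i≢j = sym (eq-≢ λ j≡i → i≢j (sym j≡i))

  sum-zero : ∀ {n} {f : Vector ℕ n} → (∀ i → f i ≡ 0) → sum f ≡ 0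
  sum-zero {n} f≡0 = trans (sum-cong-≗ f≡0) (trans (sum-const n 0) (ℕ.*-zeroʳ n))

  sum-eq : ∀ {n} (i : Fin n) (f : Vector ℕ n) → ∑[ j < n ] (eq i j * f j) ≡ f i
  sum-eq zero f = trans (cong (f zero + 0 +_) (sum-zero {f = λ j → eq zero (suc j) * f (suc j)} λ _ → refl))
    (trans (ℕ.+-identityʳ _) (ℕ.+-identityʳ _))
  sum-eq (suc i) f = sum-eq i λ j → f (suc j)

  sum-eq₁ : ∀ {n} (i : Fin n) → ∑[ j < n ] (eq i j) ≡ 1
  sum-eq₁ i = trans (sum-cong-≗ λ j → sym (ℕ.*-identityʳ (eq i j))) (sum-eq i λ _ → 1)

  sum-*-sum : ∀ {m n} (f : Vector ℕ m) (g : Vector ℕ n) →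
              sum f * sum g ≡ ∑[ i < m ] ∑[ j < n ] (f i * g j)
  sum-*-sum f g = trans (*-distribʳ-sum (sum g) f) (sum-cong-≗ λ i → *-distribˡ-sum (f i) g)

  -- The projective plane of order 4

  -- PG(2,4) in its cyclic form: {0, 1, 4, 14, 16} is a perfect difference set modulo 21.
  opaque
    difference : Fin 5 → ℕ
    difference = lookup (0 ∷ 1 ∷ 4 ∷ 14 ∷ 16 ∷ [])

    pt : Fin 21 → Fin 5 → Fin 21
    pt m k = (toℕ m + difference k) mod 21

    ln : Fin 21 → Fin 5 → Fin 21
    ln x k = (toℕ x + (21 ∸ difference k)) mod 21

  incidence : Fin 21 → Fin 21 → ℕ
  incidence m z = ∑[ k < 5 ] (eq (pt m k) z)

  opaque
    unfolding pt ln

    pt-ln : ∀ x k → pt (ln x k) k ≡ x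
    pt-ln = from-yes (Fin.all? λ x → Fin.all? λ k → pt (ln x k) k Fin.≟ x)

    ln-injective : ∀ x j k → ln x j ≡ ln x k → j ≡ k
    ln-injective = from-yes (Fin.all? λ x → Fin.all? λ j → Fin.all? λ k →
      (ln x j Fin.≟ ln x k) →-dec (j Fin.≟ k))

    ln-pt : ∀ m k → ln (pt m k) k ≡ m
    ln-pt = from-yes (Fin.all? λ m → Fin.all? λ k → ln (pt m k) k Fin.≟ m)

    pt-injective : ∀ m j k → pt m j ≡ pt m k → j ≡ k
    pt-injective = from-yes (Fin.all? λ m → Fin.all? λ j → Fin.all? λ k →
      (pt m j Fin.≟ pt m k) →-dec (j Fin.≟ k))

    incidence≤1 : ∀ m z → incidence m z ≤ 1
    incidence≤1 = from-yes (Fin.all? λ m → Fin.all? λ z → incidence m z ℕ.≤? 1)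

    pencil-incidence : ∀ x z → ∑[ k < 5 ] (incidence (ln x k) z) ≡ 1 + 4 * eq x z
    pencil-incidence = from-yes (Fin.all? λ x → Fin.all? λ z →
      ∑[ k < 5 ] (incidence (ln x k) z) ℕ.≟ 1 + 4 * eq x z)

    lines-meet : ∀ a b → ∃₂ λ j k → pt a j ≡ pt b k
    lines-meet = from-yes (Fin.all? λ a → Fin.all? λ b →
      Fin.any? λ j → Fin.any? λ k → pt a j Fin.≟ pt b k)

    meet-unique : ∀ a b j k → a ≢ b → pt a j ≡ pt b k →
                  ∀ z → incidence a z * incidence b z ≡ eq (pt a j) z
    meet-unique = from-yes (Fin.all? λ a → Fin.all? λ b → Fin.all? λ j → Fin.all? λ k →
      ¬? (a Fin.≟ b) →-dec ((pt a j Fin.≟ pt b k) →-dec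
        (Fin.all? λ z → incidence a z * incidence b z ℕ.≟ eq (pt a j) z)))

  meet-once : ∀ {a b} → a ≢ b → ∀ {j k j′ k′} → pt a j ≡ pt b k → pt a j′ ≡ pt b k′ → pt a j ≡ pt a j′
  meet-once {a} {b} a≢b {j} {k} {j′} {k′} e e′ = eq≡1⇒≡ (trans
    (sym (meet-unique a b j k a≢b e (pt a j′)))
    (trans (meet-unique a b j′ k′ a≢b e′ (pt a j′)) (eq-refl (pt a j′))))

  module Weighted (δ : Fin 21 → ℕ) where

    D : Fin 21 → ℕ
    D m = ∑[ k < 5 ] δ (pt m k)

    D-incidence : ∀ m → D m ≡ ∑[ z < 21 ] (incidence m z * δ z)
    D-incidence m = sym (begin
      ∑[ z < 21 ] (incidence m z * δ z)
        ≡⟨ sum-cong-≗ (λ z → *-distribʳ-sum (δ z) λ k → eq (pt m k) z) ⟩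
      ∑[ z < 21 ] ∑[ k < 5 ] (eq (pt m k) z * δ z)
        ≡⟨ ∑-comm (λ z k → eq (pt m k) z * δ z) ⟩
      ∑[ k < 5 ] ∑[ z < 21 ] (eq (pt m k) z * δ z)
        ≡⟨ sum-cong-≗ (λ k → sum-eq (pt m k) δ) ⟩
      D m ∎)
      where open ≡-Reasoning

    pencil : ∀ x → ∑[ k < 5 ] D (ln x k) ≡ sum δ + 4 * δ x
    pencil x = begin
      ∑[ k < 5 ] D (ln x k)
        ≡⟨ sum-cong-≗ (λ k → D-incidence (ln x k)) ⟩
      ∑[ k < 5 ] ∑[ z < 21 ] (incidence (ln x k) z * δ z)
        ≡⟨ ∑-comm (λ k z → incidence (ln x k) z * δ z) ⟩
      ∑[ z < 21 ] ∑[ k < 5 ] (incidence (ln x k) z * δ z)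
        ≡⟨ sum-cong-≗ (λ z → trans (sym (*-distribʳ-sum (δ z) λ k → incidence (ln x k) z))
             (trans (cong (_* δ z) (pencil-incidence x z)) (expand (δ z) (eq x z)))) ⟩
      ∑[ z < 21 ] (δ z + 4 * (eq x z * δ z))
        ≡⟨ ∑-distrib-+ δ (λ z → 4 * (eq x z * δ z)) ⟩
      sum δ + ∑[ z < 21 ] (4 * (eq x z * δ z))
        ≡⟨ cong (sum δ +_) (trans (sym (*-distribˡ-sum 4 λ z → eq x z * δ z)) (cong (4 *_) (sum-eq x δ))) ⟩
      sum δ + 4 * δ x ∎
      where
      open ≡-Reasoning
      expand : ∀ d e → (1 + 4 * e) * d ≡ d + 4 * (e * d)
      expand = solve-∀

    shared : Fin 21 → Fin 21 → ℕ
    shared a b = ∑[ z < 21 ] (incidence a z * incidence b z * δ z)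

    shared-meet : ∀ {a b} j k → a ≢ b → pt a j ≡ pt b k → shared a b ≡ δ (pt a j)
    shared-meet {a} {b} j k a≢b e = trans
      (sum-cong-≗ λ z → cong (_* δ z) (meet-unique a b j k a≢b e z)) (sum-eq (pt a j) δ)

    -- Inclusion-exclusion class by class: 0-1 numbers satisfy
    -- `i + j + k ≤ 1 + i * j + i * k + j * k`, here weighted by `δ` and summed. For distinct lines
    -- each `shared` term is the weight of one intersection point.
    three-lines : ∀ a b c → D a + D b + D c ≤ sum δ + shared a b + shared a c + shared b c
    three-lines a b c = begin
      D a + D b + D c
        ≡⟨ cong₂ _+_ (cong₂ _+_ (D-incidence a) (D-incidence b)) (D-incidence c) ⟩
      sum (on a) + sum (on b) + sum (on c)
        ≡⟨ trans (cong (_+ sum (on c)) (sym (∑-distrib-+ (on a) (on b))))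
                 (sym (∑-distrib-+ (λ z → on a z + on b z) (on c))) ⟩
      ∑[ z < 21 ] (on a z + on b z + on c z)
        ≤⟨ sum-mono (λ z → pointwise {d = δ z} (incidence≤1 a z) (incidence≤1 b z) (incidence≤1 c z)) ⟩
      ∑[ z < 21 ] (δ z + both a b z + both a c z + both b c z)
        ≡⟨ trans (∑-distrib-+ (λ z → δ z + both a b z + both a c z) (both b c))
             (cong (_+ shared b c) (trans (∑-distrib-+ (λ z → δ z + both a b z) (both a c))
               (cong (_+ shared a c) (∑-distrib-+ δ (both a b))))) ⟩
      sum δ + shared a b + shared a c + shared b c ∎
      where
      open ℕ.≤-Reasoning
      on : Fin 21 → Fin 21 → ℕ
      on m z = incidence m z * δ z
      both : Fin 21 → Fin 21 → Fin 21 → ℕ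
      both m m′ z = incidence m z * incidence m′ z * δ z
      boolean : ∀ {i j k} → i ≤ 1 → j ≤ 1 → k ≤ 1 → i + j + k ≤ 1 + i * j + i * k + j * k
      boolean z≤n       z≤n       k≤1       = ℕ.≤-trans k≤1 (ℕ.m≤m+n 1 _)
      boolean z≤n       (s≤s z≤n) z≤n       = s≤s z≤n
      boolean z≤n       (s≤s z≤n) (s≤s z≤n) = s≤s (s≤s z≤n)
      boolean (s≤s z≤n) z≤n       z≤n       = s≤s z≤n
      boolean (s≤s z≤n) z≤n       (s≤s z≤n) = s≤s (s≤s z≤n)
      boolean (s≤s z≤n) (s≤s z≤n) z≤n       = s≤s (s≤s z≤n)
      boolean (s≤s z≤n) (s≤s z≤n) (s≤s z≤n) = s≤s (s≤s (s≤s z≤n))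
      collect : ∀ i j k d → (i + j + k) * d ≡ i * d + j * d + k * d
      collect = solve-∀
      spread : ∀ i j k d → (1 + i * j + i * k + j * k) * d ≡ d + i * j * d + i * k * d + j * k * d
      spread = solve-∀
      pointwise : ∀ {i j k d} → i ≤ 1 → j ≤ 1 → k ≤ 1 →
                  i * d + j * d + k * d ≤ d + i * j * d + i * k * d + j * k * d
      pointwise {i} {j} {k} {d} p q r =
        subst₂ _≤_ (collect i j k d) (spread i j k d) (ℕ.*-monoˡ-≤ d (boolean p q r))

    two-lines : ∀ a b → D a + D b ≤ sum δ + shared a b
    two-lines a b = begin
      D a + D b
        ≡⟨ cong₂ _+_ (D-incidence a) (D-incidence b) ⟩
      ∑[ z < 21 ] (incidence a z * δ z) + ∑[ z < 21 ] (incidence b z * δ z)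
        ≡⟨ ∑-distrib-+ (λ z → incidence a z * δ z) (λ z → incidence b z * δ z) ⟨
      ∑[ z < 21 ] (incidence a z * δ z + incidence b z * δ z)
        ≤⟨ sum-mono (λ z → pointwise {d = δ z} (incidence≤1 a z) (incidence≤1 b z)) ⟩
      ∑[ z < 21 ] (δ z + incidence a z * incidence b z * δ z)
        ≡⟨ ∑-distrib-+ δ (λ z → incidence a z * incidence b z * δ z) ⟩
      sum δ + shared a b ∎
      where
      open ℕ.≤-Reasoning
      boolean : ∀ {i j} → i ≤ 1 → j ≤ 1 → i + j ≤ 1 + i * j
      boolean z≤n       j≤1 = ℕ.≤-trans j≤1 (ℕ.m≤m+n 1 _)
      boolean (s≤s z≤n) j≤1 = s≤s (ℕ.m≤m+n _ 0)
      pointwise : ∀ {i j d} → i ≤ 1 → j ≤ 1 → i * d + j * d ≤ d + i * j * d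
      pointwise {i} {j} {d} p q =
        subst₂ _≤_ (ℕ.*-distribʳ-+ d i j)
          (trans (ℕ.*-distribʳ-+ d 1 (i * j)) (cong (_+ i * j * d) (ℕ.*-identityˡ d)))
          (ℕ.*-monoˡ-≤ d (boolean p q))

  -- Line classes as orthogonal arrays

  -- The 16 lines of a line class, with c k q the segment that line q cuts out of the k-th
  -- point class, form an orthogonal array of strength 2 (an affine plane of order 4).
  module Net {r N d : ℕ} (c : Fin r → Fin N → Fin d) (other : ∀ (k : Fin r) → ∃ λ l → k ≢ l)
    (orthogonal : ∀ j k → j ≢ k → ∀ s t → ∑[ q < N ] (eq (c j q) s * eq (c k q) t) ≡ 1) where

    -- Each pair of segments in two different classes lies on exactly one line, so the sum over
    -- lines runs once over all pairs `(s , t)` and factors.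
    pair-sum : ∀ {j k} → j ≢ k → (f g : Vector ℕ d) →
               ∑[ q < N ] (f (c j q) * g (c k q)) ≡ sum f * sum g
    pair-sum {j} {k} j≢k f g = begin
      ∑[ q < N ] (f (c j q) * g (c k q))
        ≡⟨ sum-cong-≗ (λ q → trans (sym (cong₂ _*_ (sum-eq (c j q) f) (sum-eq (c k q) g)))
             (sum-*-sum (λ s → eq (c j q) s * f s) (λ t → eq (c k q) t * g t))) ⟩
      ∑[ q < N ] ∑[ s < d ] ∑[ t < d ] term q s t
        ≡⟨ ∑-comm (λ q s → ∑[ t < d ] term q s t) ⟩
      ∑[ s < d ] ∑[ q < N ] ∑[ t < d ] term q s t
        ≡⟨ sum-cong-≗ (λ s → ∑-comm λ q t → term q s t) ⟩
      ∑[ s < d ] ∑[ t < d ] ∑[ q < N ] term q s t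
        ≡⟨ sum-cong-≗ (λ s → sum-cong-≗ λ t → collapse s t) ⟩
      ∑[ s < d ] ∑[ t < d ] (f s * g t)
        ≡⟨ sum-*-sum f g ⟨
      sum f * sum g ∎
      where
      open ≡-Reasoning
      term : Fin N → Fin d → Fin d → ℕ
      term q s t = (eq (c j q) s * f s) * (eq (c k q) t * g t)
      regroup : ∀ a b x y → (a * x) * (b * y) ≡ (x * y) * (a * b)
      regroup = solve-∀
      collapse : ∀ s t → ∑[ q < N ] term q s t ≡ f s * g t
      collapse s t = begin
        ∑[ q < N ] term q s t
          ≡⟨ sum-cong-≗ (λ q → regroup (eq (c j q) s) (eq (c k q) t) (f s) (g t)) ⟩
        ∑[ q < N ] (f s * g t * (eq (c j q) s * eq (c k q) t))
          ≡⟨ *-distribˡ-sum (f s * g t) (λ q → eq (c j q) s * eq (c k q) t) ⟨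
        f s * g t * ∑[ q < N ] (eq (c j q) s * eq (c k q) t)
          ≡⟨ cong (f s * g t *_) (orthogonal j k j≢k s t) ⟩
        f s * g t * 1
          ≡⟨ ℕ.*-identityʳ (f s * g t) ⟩
        f s * g t ∎

    -- Pairing with the constant 1 on a second class shows that each segment lies on `d` lines.
    single-sum : ∀ k (f : Vector ℕ d) → ∑[ q < N ] f (c k q) ≡ d * sum f
    single-sum k f = begin
      ∑[ q < N ] f (c k q)        ≡⟨ sum-cong-≗ (λ q → sym (ℕ.*-identityʳ (f (c k q)))) ⟩
      ∑[ q < N ] (f (c k q) * 1)  ≡⟨ pair-sum (proj₂ (other k)) f (λ _ → 1) ⟩
      sum f * ∑[ s < d ] 1         ≡⟨ cong (sum f *_) (trans (sum-const d 1) (ℕ.*-identityʳ d)) ⟩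
      sum f * d                    ≡⟨ ℕ.*-comm (sum f) d ⟩
      d * sum f                    ∎
      where
      open ≡-Reasoning

    module _ (n : Fin r → Fin d → ℕ) where

      on : Fin N → ℕ
      on q = ∑[ k < r ] n k (c k q)

      weight : Fin r → ℕ
      weight k = sum (n k)

      first-moment : ∑[ q < N ] on q ≡ d * sum weight
      first-moment = begin
        ∑[ q < N ] ∑[ k < r ] n k (c k q)  ≡⟨ ∑-comm (λ q k → n k (c k q)) ⟩
        ∑[ k < r ] ∑[ q < N ] n k (c k q)  ≡⟨ sum-cong-≗ (λ k → single-sum k (n k)) ⟩
        ∑[ k < r ] (d * weight k)           ≡⟨ *-distribˡ-sum d weight ⟨
        d * sum weight                      ∎
        where open ≡-Reasoning

      -- After squaring, products over two different classes factor by `pair-sum`, while the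
      -- diagonal terms are counted by `single-sum`. Adding the squared weights on the left
      -- completes the off-diagonal terms to a full square without subtraction.
      second-moment : ∑[ q < N ] (on q * on q) + ∑[ k < r ] (weight k * weight k)
                    ≡ sum weight * sum weight + d * ∑[ k < r ] ∑[ s < d ] (n k s * n k s)
      second-moment = begin
        ∑[ q < N ] (on q * on q) + ∑[ k < r ] (weight k * weight k)
          ≡⟨ cong₂ _+_ expand (sum-cong-≗ λ k → sym (sum-eq k λ l → weight k * weight l)) ⟩
        ∑[ k < r ] ∑[ l < r ] mixed k l + ∑[ k < r ] ∑[ l < r ] (eq k l * (weight k * weight l))
          ≡⟨ merge mixed (λ k l → eq k l * (weight k * weight l)) ⟩
        ∑[ k < r ] ∑[ l < r ] (mixed k l + eq k l * (weight k * weight l))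
          ≡⟨ sum-cong-≗ (λ k → sum-cong-≗ λ l → entry k l) ⟩
        ∑[ k < r ] ∑[ l < r ] (weight k * weight l + eq k l * (d * square k))
          ≡⟨ merge (λ k l → weight k * weight l) (λ k l → eq k l * (d * square k)) ⟨
        ∑[ k < r ] ∑[ l < r ] (weight k * weight l) + ∑[ k < r ] ∑[ l < r ] (eq k l * (d * square k))
          ≡⟨ cong₂ _+_ (sym (sum-*-sum weight weight))
               (trans (sum-cong-≗ λ k → sum-eq k λ _ → d * square k) (sym (*-distribˡ-sum d square))) ⟩
        sum weight * sum weight + d * sum square ∎
        where
        open ≡-Reasoning
        square : Fin r → ℕ
        square k = ∑[ s < d ] (n k s * n k s)
        mixed : Fin r → Fin r → ℕ
        mixed k l = ∑[ q < N ] (n k (c k q) * n l (c l q))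
        merge : (f g : Fin r → Fin r → ℕ) →
                ∑[ k < r ] ∑[ l < r ] f k l + ∑[ k < r ] ∑[ l < r ] g k l
                ≡ ∑[ k < r ] ∑[ l < r ] (f k l + g k l)
        merge f g = sym (trans (sum-cong-≗ λ k → ∑-distrib-+ (f k) (g k))
          (∑-distrib-+ (λ k → sum (f k)) (λ k → sum (g k))))
        expand : ∑[ q < N ] (on q * on q) ≡ ∑[ k < r ] ∑[ l < r ] mixed k l
        expand = begin
          ∑[ q < N ] (on q * on q)
            ≡⟨ sum-cong-≗ (λ q → sum-*-sum (λ k → n k (c k q)) (λ l → n l (c l q))) ⟩
          ∑[ q < N ] ∑[ k < r ] ∑[ l < r ] (n k (c k q) * n l (c l q))
            ≡⟨ ∑-comm (λ q k → ∑[ l < r ] (n k (c k q) * n l (c l q))) ⟩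
          ∑[ k < r ] ∑[ q < N ] ∑[ l < r ] (n k (c k q) * n l (c l q))
            ≡⟨ sum-cong-≗ (λ k → ∑-comm λ q l → n k (c k q) * n l (c l q)) ⟩
          ∑[ k < r ] ∑[ l < r ] mixed k l ∎
        entry : ∀ k l → mixed k l + eq k l * (weight k * weight l)
                      ≡ weight k * weight l + eq k l * (d * square k)
        entry k l with k Fin.≟ l
        ... | yes refl rewrite single-sum k (λ s → n k s * n k s) = swapped (d * square k) (weight k * weight k)
          where
          swapped : ∀ a b → a + (b + 0) ≡ b + (a + 0)
          swapped = solve-∀
        ... | no k≢l = cong (_+ 0) (pair-sum k≢l (n k) (n l))

      -- The lines through segment `s` of class `j` meet every segment of the other classes exactly
      -- once and contain `s` itself `d` times.
      through : ∀ j s → ∑[ q < N ] (eq (c j q) s * on q) + weight j ≡ sum weight + d * n j s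
      through j s = begin
        ∑[ q < N ] (eq (c j q) s * on q) + weight j
          ≡⟨ cong₂ _+_ expand (sym (sum-eq j weight)) ⟩
        ∑[ k < r ] mixed k + ∑[ k < r ] (eq j k * weight k)
          ≡⟨ ∑-distrib-+ mixed (λ k → eq j k * weight k) ⟨
        ∑[ k < r ] (mixed k + eq j k * weight k)
          ≡⟨ sum-cong-≗ entry ⟩
        ∑[ k < r ] (weight k + eq j k * (d * n j s))
          ≡⟨ ∑-distrib-+ weight (λ k → eq j k * (d * n j s)) ⟩
        sum weight + ∑[ k < r ] (eq j k * (d * n j s))
          ≡⟨ cong (sum weight +_) (sum-eq j λ _ → d * n j s) ⟩
        sum weight + d * n j s ∎
        where
        open ≡-Reasoning
        mixed : Fin r → ℕ
        mixed k = ∑[ q < N ] (eq (c j q) s * n k (c k q))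
        expand : ∑[ q < N ] (eq (c j q) s * on q) ≡ sum mixed
        expand = trans
          (sum-cong-≗ λ q → *-distribˡ-sum (eq (c j q) s) λ k → n k (c k q))
          (∑-comm λ q k → eq (c j q) s * n k (c k q))
        indicator : ∀ (f : Vector ℕ d) → ∑[ u < d ] (eq u s * f u) ≡ f s
        indicator f = trans (sum-cong-≗ λ u → cong (_* f u) (eq-sym u s)) (sum-eq s f)
        entry : ∀ k → mixed k + eq j k * weight k ≡ weight k + eq j k * (d * n j s)
        entry k with j Fin.≟ k
        ... | yes refl rewrite single-sum j (λ u → eq u s * n j u) | indicator (n j) = swapped (d * n k s) (weight k)
          where
          swapped : ∀ a b → a + (b + 0) ≡ b + (a + 0)
          swapped = solve-∀
        ... | no j≢k = cong (_+ 0) (trans (pair-sum j≢k (λ u → eq u s) (n k))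
          (trans (cong (_* weight k) (trans (sum-cong-≗ λ u → eq-sym u s) (sum-eq₁ s)))
            (ℕ.*-identityˡ (weight k))))

      module _ {b : ℕ} (bound : ∀ q → on q ≤ b) where

        segment-lines : ∀ j s → ∑[ q < N ] (eq (c j q) s * b) ≡ d * b
        segment-lines j s = trans (single-sum j λ u → eq u s * b) (cong (d *_)
          (trans (sum-cong-≗ λ u → cong (_* b) (eq-sym u s)) (sum-eq s λ _ → b)))

        segment-bound : ∀ j s → d * n j s + sum weight ≤ d * b + weight j
        segment-bound j s = begin
          d * n j s + sum weight                          ≡⟨ ℕ.+-comm (d * n j s) (sum weight) ⟩
          sum weight + d * n j s                          ≡⟨ through j s ⟨
          ∑[ q < N ] (eq (c j q) s * on q) + weight j    ≤⟨ ℕ.+-monoˡ-≤ (weight j) (sum-mono λ q →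
                                                               ℕ.*-monoʳ-≤ (eq (c j q) s) (bound q)) ⟩
          ∑[ q < N ] (eq (c j q) s * b) + weight j       ≡⟨ cong (_+ weight j) (segment-lines j s) ⟩
          d * b + weight j                                   ∎
          where open ℕ.≤-Reasoning

        -- The hypothesis is equality in `segment-bound`, which leaves no slack on any line through
        -- the segment.
        saturated : ∀ j q → d * b + weight j ≤ d * n j (c j q) + sum weight → on q ≡ b
        saturated j q tight = begin
          on q                        ≡⟨ ℕ.*-identityˡ (on q) ⟨
          1 * on q                    ≡⟨ cong (_* on q) (eq-refl (c j q)) ⟨
          eq (c j q) (c j q) * on q   ≡⟨ sum-tight
                                           (λ r → ℕ.*-monoʳ-≤ (eq (c j r) (c j q)) (bound r)) total q ⟩
          eq (c j q) (c j q) * b      ≡⟨ trans (cong (_* b) (eq-refl (c j q))) (ℕ.*-identityˡ b) ⟩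
          b                           ∎
          where
          open ≡-Reasoning
          total : ∑[ r < N ] (eq (c j r) (c j q) * b) ≤ ∑[ r < N ] (eq (c j r) (c j q) * on r)
          total = ℕ.+-cancelʳ-≤ (weight j) _ _ (ℕ.≤-trans
            (ℕ.≤-reflexive (cong (_+ weight j) (segment-lines j (c j q))))
            (ℕ.≤-trans tight (ℕ.≤-reflexive (trans (ℕ.+-comm (d * n j (c j q)) (sum weight))
              (sym (through j (c j q)))))))

  -- Line classes of total deficit 4

  support : ℕ → ℕ
  support zero    = 0
  support (suc _) = 1

  -- The number of points of K in a class of positive deficit. Full classes give 0, so that totals
  -- run over the deficient classes alone.
  residual : ℕ → ℕ
  residual δ = support δ * (4 ∸ δ)

  totalResidual squareResidual : (Fin 5 → ℕ) → ℕ
  totalResidual  δ = ∑[ k < 5 ] residual (δ k)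
  squareResidual δ = ∑[ k < 5 ] (residual (δ k) * residual (δ k))

  -- The sum over 16 lines of `4 (X - 1)² ≤ φ`, where `X` has sum `4 Ω` and sum of squares
  -- `Ω² + 4 Ω - S`, and `φ` has sum 16.
  Bounded : ℕ → ℕ → Set
  Bounded Ω S = 4 * (Ω * Ω + 4 * Ω) + 64 ≤ 32 * Ω + 16 + 4 * S

  -- With at most one entry equal to 1, the nonzero entries are 4, or 3 and 1, or 2 and 2. The two
  -- sides of `Bounded` are then 64 and 16, 192 and 184, or 192 and 176.
  Deficits : Vec ℕ 5 → Set
  Deficits δ = sum (lookup δ) ≡ 4 → (∀ j k → lookup δ j ≡ 1 → lookup δ k ≡ 1 → j ≡ k) →
    (∃₂ λ j k → j ≢ k × lookup δ j ≡ 0 × lookup δ k ≡ 0) ×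
    ∑[ k < 5 ] support (lookup δ k) ≤ 2 ×
    ¬ Bounded (totalResidual (lookup δ)) (squareResidual (lookup δ))

  deficits : ∀ {a} → a < 5 → ∀ {b} → b < 5 → ∀ {c} → c < 5 → ∀ {d} → d < 5 → ∀ {e} → e < 5 →
             Deficits (a ∷ b ∷ c ∷ d ∷ e ∷ [])
  deficits = from-yes
    (ℕ.allUpTo? (λ a → ℕ.allUpTo? (λ b → ℕ.allUpTo? (λ c → ℕ.allUpTo? (λ d → ℕ.allUpTo? (λ e →
      deficits? (a ∷ b ∷ c ∷ d ∷ e ∷ [])) 5) 5) 5) 5) 5)
    where
    deficits? : ∀ δ → Dec (Deficits δ)
    deficits? δ = (_ ℕ.≟ _) →-dec
      ((Fin.all? λ j → Fin.all? λ k → (_ ℕ.≟ _) →-dec ((_ ℕ.≟ _) →-dec (j Fin.≟ k))) →-dec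
       ((Fin.any? λ j → Fin.any? λ k → ¬? (j Fin.≟ k) ×-dec (_ ℕ.≟ _) ×-dec (_ ℕ.≟ _))
         ×-dec (_ ℕ.≤? _) ×-dec ¬? (_ ℕ.≤? _)))

  moment-arithmetic : ∀ Ω S A B → A + S ≡ Ω * Ω + 4 * Ω → B ≡ 4 * Ω → 4 * A + 64 ≤ 8 * B + 16 →
                Bounded Ω S
  moment-arithmetic Ω S A B moment refl le = linear 0 (le +≤ 4 *≤ ℕ.≤-reflexive (sym moment)) (identity Ω S A)
    where
    identity : ∀ Ω S A → 4 * (Ω * Ω + 4 * Ω) + 64 + (8 * (4 * Ω) + 16 + 4 * (A + S)) + 0
                       ≡ 32 * Ω + 16 + 4 * S + (4 * A + 64 + 4 * (Ω * Ω + 4 * Ω))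
    identity = solve-∀

  module _ {N : ℕ} (c : Fin 5 → Fin N → Fin 4) (other : ∀ (k : Fin 5) → ∃ λ l → k ≢ l)
    (orthogonal : ∀ j k → j ≢ k → ∀ s t → ∑[ q < N ] (eq (c j q) s * eq (c k q) t) ≡ 1) where

    open Net c other orthogonal

    module _ (n : Fin 5 → Fin 4 → ℕ) (δ : Fin 5 → ℕ)
      (complement : ∀ k → sum (n k) + δ k ≡ 4) (Σδ≡4 : sum δ ≡ 4) (bound : ∀ q → on n q ≤ 5)
      (doubled : ∀ k → δ k ≡ 0 → ∀ s → n k s ≡ 0 ⊎ n k s ≡ 2)
      (flat : ∀ k → δ k ≢ 0 → ∀ s → n k s ≤ 1) where

      private
        -- Points in full classes come in pairs on a segment and contribute an even number to every
        -- line. Points in deficient classes contribute at most 1 per segment.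
        full partial : Fin 5 → Fin 4 → ℕ
        full    k s = (1 ∸ support (δ k)) * n k s
        partial k s = support (δ k) * n k s

        X : Fin N → ℕ
        X = on partial

        partial≤ : ∀ k s → partial k s ≤ support (δ k)
        partial≤ k s with δ k in e
        ... | zero  = z≤n
        ... | suc _ = ℕ.≤-trans (ℕ.≤-reflexive (ℕ.+-identityʳ (n k s)))
                        (flat k (λ δ≡0 → contradiction (trans (sym e) δ≡0) λ ()) s)

        partial-weight : ∀ k → sum (partial k) ≡ residual (δ k)
        partial-weight k = trans (sym (*-distribˡ-sum (support (δ k)) (n k)))
          (cong (support (δ k) *_) (trans (sym (ℕ.m+n∸n≡m (sum (n k)) (δ k)))
            (cong (_∸ δ k) (complement k))))

        partial-square : ∀ k s → partial k s * partial k s ≡ partial k s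
        partial-square k s = idempotent (ℕ.≤-trans (partial≤ k s) (support≤1 (δ k)))
          where
          support≤1 : ∀ d → support d ≤ 1
          support≤1 zero    = z≤n
          support≤1 (suc _) = s≤s z≤n
          idempotent : ∀ {m} → m ≤ 1 → m * m ≡ m
          idempotent z≤n       = refl
          idempotent (s≤s z≤n) = refl

        split : ∀ q → on n q ≡ on full q + X q
        split q = trans (sum-cong-≗ λ k → halves (δ k) (n k (c k q)))
          (∑-distrib-+ (λ k → full k (c k q)) (λ k → partial k (c k q)))
          where
          halves : ∀ d m → m ≡ (1 ∸ support d) * m + support d * m
          halves zero    m = sym (trans (ℕ.+-identityʳ (m + 0)) (ℕ.+-identityʳ m))
          halves (suc _) m = sym (ℕ.+-identityʳ m)

        even : ∀ q → 2 ∣ on full q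
        even q = sum-even (λ k → full k (c k q)) λ k → even-term k (c k q)
          where
          even-term : ∀ k s → 2 ∣ full k s
          even-term k s with δ k in e
          ... | suc _ = 2 ∣0
          ... | zero with doubled k e s
          ...   | inj₁ p rewrite p = 2 ∣0
          ...   | inj₂ p rewrite p = ∣-refl

        odd-part : ∀ {f} x → 2 ∣ f → x ≤ 2 → f + x ≡ 5 → x ≡ 1
        odd-part 0 2∣f _ e = contradiction
          (subst (2 ∣_) (trans (sym (ℕ.+-identityʳ _)) e) 2∣f) (from-no (2 ∣? 5))
        odd-part 1 _ _ _ = refl
        odd-part {f} 2 2∣f _ e = contradiction
          (subst (2 ∣_) (ℕ.+-cancelʳ-≡ 2 f 3 e) 2∣f) (from-no (2 ∣? 3))
        odd-part (suc (suc (suc _))) _ (s≤s (s≤s ())) _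

        weights : sum (weight n) ≡ 16
        weights = ℕ.+-cancelʳ-≡ 4 (sum (weight n)) 16 (trans (cong (sum (weight n) +_) (sym Σδ≡4))
          (trans (sym (∑-distrib-+ (weight n) δ)) (trans (sum-cong-≗ complement) (sum-const 5 4))))

      private
        Ω S : ℕ
        Ω = totalResidual δ
        S = squareResidual δ

        total : ∑[ q < N ] 4 ≡ 64
        total = single-sum zero λ _ → 4

        first : ∑[ q < N ] X q ≡ 4 * Ω
        first = trans (first-moment partial) (cong (4 *_) (sum-cong-≗ partial-weight))

        second : ∑[ q < N ] (X q * X q) + S ≡ Ω * Ω + 4 * Ω
        second = trans
          (cong (∑[ q < N ] (X q * X q) +_)
            (sum-cong-≗ λ l → sym (cong₂ _*_ (partial-weight l) (partial-weight l))))
          (trans (second-moment partial) (cong₂ _+_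
            (cong₂ _*_ (sum-cong-≗ partial-weight) (sum-cong-≗ partial-weight))
            (cong (4 *_) (sum-cong-≗ λ l → trans (sum-cong-≗ (partial-square l)) (partial-weight l)))))

        -- The summand is 2 on the two empty segments of a full class and 0 on its two doubled ones.
        missing : ∀ l → δ l ≡ 0 → ∑[ s < 4 ] (2 ∸ n l s) ≡ 4
        missing l δl≡0 = ℕ.+-cancelʳ-≡ 4 (∑[ s < 4 ] (2 ∸ n l s)) 4 (trans
          (cong (∑[ s < 4 ] (2 ∸ n l s) +_) (trans (sym (complement l))
            (trans (cong (sum (n l) +_) δl≡0) (ℕ.+-identityʳ (sum (n l))))))
          (trans (sym (∑-distrib-+ (λ s → 2 ∸ n l s) (n l)))
            (trans (sum-cong-≗ cancel) (sum-const 4 2))))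
          where
          cancel : ∀ s → (2 ∸ n l s) + n l s ≡ 2
          cancel s with doubled l δl≡0 s
          ... | inj₁ p rewrite p = refl
          ... | inj₂ p rewrite p = refl

      -- A line through a doubled segment of a full class is saturated, and the full classes
      -- contribute an even number to it, so the classes with a deficit contribute exactly 1.
      -- The second moment of that contribution X over the lines of the class is then too big
      -- for the four lines that miss the doubled segments of two full classes.
      second-moment-≤ : ∀ j k → j ≢ k → δ j ≡ 0 → δ k ≡ 0 → ∑[ l < 5 ] support (δ l) ≤ 2 →
        Bounded (totalResidual δ) (squareResidual δ)
      second-moment-≤ j k j≢k δj≡0 δk≡0 few =
        moment-arithmetic Ω S (∑[ q < N ] (X q * X q)) (∑[ q < N ] X q) second first
          (subst₂ _≤_
            (trans (∑-distrib-+ (λ q → 4 * (X q * X q)) (λ _ → 4))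
              (cong₂ _+_ (sym (*-distribˡ-sum 4 λ q → X q * X q)) total))
            (trans (∑-distrib-+ (λ q → 8 * X q) φ)
              (cong₂ _+_ (sym (*-distribˡ-sum 8 X)) φ-total))
            (sum-mono pointwise))
        where
        -- The value is 4 on a line avoiding the doubled segments of both `j` and `k`, and 0 on
        -- every other line.
        φ : Fin N → ℕ
        φ q = (2 ∸ n j (c j q)) * (2 ∸ n k (c k q))

        X≤2 : ∀ q → X q ≤ 2
        X≤2 q = ℕ.≤-trans (sum-mono λ l → partial≤ l (c l q)) few

        saturates : ∀ l q → δ l ≡ 0 → n l (c l q) ≡ 2 → X q ≡ 1
        saturates l q δl≡0 two = odd-part {on full q} (X q) (even q) (X≤2 q)
          -- Equality holds in the segment bound: `4 * 5 + 4 = 4 * 2 + 16`.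
          (trans (sym (split q)) (saturated n bound l q (ℕ.≤-reflexive
            (trans (cong (20 +_) weight≡4) (sym (cong₂ (λ a b → 4 * a + b) two weights))))))
          where
          weight≡4 : weight n l ≡ 4
          weight≡4 = trans (sym (ℕ.+-identityʳ (weight n l)))
            (trans (cong (weight n l +_) (sym δl≡0)) (complement l))

        -- This is `4 (X - 1)² ≤ φ` without subtraction: `X` is 1 wherever `φ` vanishes, and at most
        -- 2 elsewhere.
        pointwise : ∀ q → 4 * (X q * X q) + 4 ≤ 8 * X q + φ q
        pointwise q = parabola (X q) (φ q) (split-φ (doubled j δj≡0 (c j q)) (doubled k δk≡0 (c k q)))
          where
          split-φ : n j (c j q) ≡ 0 ⊎ n j (c j q) ≡ 2 → n k (c k q) ≡ 0 ⊎ n k (c k q) ≡ 2 →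
                    X q ≡ 1 ⊎ (X q ≤ 2 × φ q ≡ 4)
          split-φ (inj₂ p) _        = inj₁ (saturates j q δj≡0 p)
          split-φ (inj₁ _) (inj₂ p) = inj₁ (saturates k q δk≡0 p)
          split-φ (inj₁ p) (inj₁ r) = inj₂ (X≤2 q , cong₂ (λ a b → (2 ∸ a) * (2 ∸ b)) p r)
          parabola : ∀ x y → x ≡ 1 ⊎ (x ≤ 2 × y ≡ 4) → 4 * (x * x) + 4 ≤ 8 * x + y
          parabola _ _ (inj₁ refl)                   = ℕ.m≤m+n 8 _
          parabola _ _ (inj₂ (z≤n           , refl)) = ℕ.m≤m+n 4 0
          parabola _ _ (inj₂ (s≤s z≤n       , refl)) = ℕ.m≤m+n 8 4
          parabola _ _ (inj₂ (s≤s (s≤s z≤n) , refl)) = ℕ.m≤m+n 20 0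

        φ-total : sum φ ≡ 16
        φ-total = trans (pair-sum j≢k (λ s → 2 ∸ n j s) (λ s → 2 ∸ n k s))
          (cong₂ _*_ (missing j δj≡0) (missing k δk≡0))

    -- The finite check `deficits` supplies two full classes and at most two deficient ones, and
    -- refutes the inequality that `second-moment-≤` derives from them.
    no-deficit-4 : (n : Fin 5 → Fin 4 → ℕ) (δ : Fin 5 → ℕ) →
      (∀ k → sum (n k) + δ k ≡ 4) → sum δ ≡ 4 → (∀ q → on n q ≤ 5) →
      (∀ k → δ k ≡ 0 → ∀ s → n k s ≡ 0 ⊎ n k s ≡ 2) →
      (∀ k → δ k ≢ 0 → ∀ s → n k s ≤ 1) →
      (∀ j k → δ j ≡ 1 → δ k ≡ 1 → j ≡ k) → ⊥
    no-deficit-4 n δ complement Σδ≡4 bound doubled flat unique =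
      let (j , k , j≢k , δj≡0 , δk≡0) , few , large =
            deficits (δ<5 zero) (δ<5 (suc zero)) (δ<5 (suc (suc zero)))
              (δ<5 (suc (suc (suc zero)))) (δ<5 (suc (suc (suc (suc zero))))) (trans (sum-cong-≗ at) Σδ≡4)
              (λ j k p q → unique j k (trans (sym (at j)) p) (trans (sym (at k)) q))
      in large (subst₂ Bounded
           (sum-cong-≗ λ k → cong residual (sym (at k)))
           (sum-cong-≗ λ k → cong (λ d → residual d * residual d) (sym (at k)))
           (second-moment-≤ n δ complement Σδ≡4 bound doubled flat j k j≢k
             (trans (sym (at j)) δj≡0) (trans (sym (at k)) δk≡0)
             (subst (_≤ 2) (sum-cong-≗ λ k → cong support (at k)) few)))
      where
      at : ∀ k → lookup (tabulate δ) k ≡ δ k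
      at = Vec.lookup∘tabulate δ
      δ<5 : ∀ k → δ k < 5
      δ<5 k = s≤s (ℕ.≤-trans (ℕ.m≤n+m (δ k) (sum (n k))) (ℕ.≤-reflexive (complement k)))

  -- Weights of point classes and segments

  two-terms≤sum : ∀ {n} (f : Vector ℕ n) {i j} → i ≢ j → f i + f j ≤ sum f
  two-terms≤sum f {zero}  {zero}  i≢j = contradiction refl i≢j
  two-terms≤sum f {zero}  {suc j} i≢j = ℕ.+-monoʳ-≤ (f zero) (term≤sum (λ k → f (suc k)) j)
  two-terms≤sum f {suc i} {zero}  i≢j = ℕ.≤-trans (ℕ.≤-reflexive (ℕ.+-comm (f (suc i)) (f zero)))
    (ℕ.+-monoʳ-≤ (f zero) (term≤sum (λ k → f (suc k)) i))
  two-terms≤sum f {suc i} {suc j} i≢j = ℕ.≤-trans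
    (two-terms≤sum (λ k → f (suc k)) λ i≡j → i≢j (cong suc i≡j)) (ℕ.m≤n+m _ (f zero))

  -- N points, the i-th in class cls i and on segment seg i j of that class in direction j.
  module Counts {N : ℕ} (cls : Fin N → Fin 21) (seg : Fin N → Fin 5 → Fin 4) where

    w : Fin 21 → ℕ
    w x = ∑[ i < N ] eq (cls i) x

    n : Fin 21 → Fin 5 → Fin 4 → ℕ
    n x j s = ∑[ i < N ] (eq (cls i) x * eq (seg i j) s)

    segments-partition : ∀ x j → ∑[ s < 4 ] n x j s ≡ w x
    segments-partition x j = trans (∑-comm λ s i → eq (cls i) x * eq (seg i j) s)
      (sum-cong-≗ λ i → trans (sym (*-distribˡ-sum (eq (cls i) x) λ s → eq (seg i j) s))
        (trans (cong (eq (cls i) x *_) (sum-eq₁ (seg i j))) (ℕ.*-identityʳ _)))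

    classes-partition : ∑[ x < 21 ] w x ≡ N
    classes-partition = trans (∑-comm λ x i → eq (cls i) x)
      (trans (sum-cong-≗ λ i → sum-eq₁ (cls i)) (trans (sum-const N 1) (ℕ.*-identityʳ N)))

    -- Count the ordered pairs of points of a class that agree in a given direction, over all
    -- five directions: pairs of equal points are counted five times, all others at least once.
    agreements : (∀ i i′ → i ≢ i′ → cls i ≡ cls i′ → ∃ λ j → seg i j ≡ seg i′ j) →
      ∀ x → w x * w x + 4 * w x ≤ ∑[ j < 5 ] ∑[ s < 4 ] (n x j s * n x j s)
    agreements agree x = begin
      w x * w x + 4 * w x
        ≡⟨ cong₂ _+_ (sum-*-sum e e) (*-distribˡ-sum 4 e) ⟩
      ∑[ i < N ] ∑[ i′ < N ] (e i * e i′) + ∑[ i < N ] (4 * e i)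
        ≡⟨ ∑-distrib-+ (λ i → ∑[ i′ < N ] (e i * e i′)) (λ i → 4 * e i) ⟨
      ∑[ i < N ] (∑[ i′ < N ] (e i * e i′) + 4 * e i)
        ≡⟨ sum-cong-≗ (λ i → trans
             (cong (∑[ i′ < N ] (e i * e i′) +_) (sym (sum-eq i (λ i′ → 4 * e i′))))
             (sym (∑-distrib-+ (λ i′ → e i * e i′) (λ i′ → eq i i′ * (4 * e i′))))) ⟩
      ∑[ i < N ] ∑[ i′ < N ] (e i * e i′ + eq i i′ * (4 * e i′))
        ≤⟨ sum-mono (λ i → sum-mono λ i′ → pair i i′) ⟩
      ∑[ i < N ] ∑[ i′ < N ] ∑[ j < 5 ] ∑[ s < 4 ] term j s i i′
        ≡⟨ sum-cong-≗ (λ i → trans (∑-comm λ i′ j → ∑[ s < 4 ] term j s i i′)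
             (sum-cong-≗ λ j → ∑-comm λ i′ s → term j s i i′)) ⟩
      ∑[ i < N ] ∑[ j < 5 ] ∑[ s < 4 ] ∑[ i′ < N ] term j s i i′
        ≡⟨ trans (∑-comm λ i j → ∑[ s < 4 ] ∑[ i′ < N ] term j s i i′)
             (sum-cong-≗ λ j → ∑-comm λ i s → ∑[ i′ < N ] term j s i i′) ⟩
      ∑[ j < 5 ] ∑[ s < 4 ] ∑[ i < N ] ∑[ i′ < N ] term j s i i′
        ≡⟨ sum-cong-≗ (λ j → sum-cong-≗ λ s →
             sum-*-sum (λ i → e i * eq (seg i j) s) (λ i′ → e i′ * eq (seg i′ j) s)) ⟨
      ∑[ j < 5 ] ∑[ s < 4 ] (n x j s * n x j s) ∎
      where
      open ℕ.≤-Reasoning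
      e : Fin N → ℕ
      e i = eq (cls i) x
      term : Fin 5 → Fin 4 → Fin N → Fin N → ℕ
      term j s i i′ = (e i * eq (seg i j) s) * (e i′ * eq (seg i′ j) s)
      regroup : ∀ a b c d → a * c * (b * d) ≡ a * b * (c * d)
      regroup = solve-∀
      same : Fin N → Fin N → Fin 5 → ℕ
      same i i′ j = eq (seg i′ j) (seg i j)
      collapse : ∀ i i′ → ∑[ j < 5 ] ∑[ s < 4 ] term j s i i′ ≡ e i * e i′ * sum (same i i′)
      collapse i i′ = begin-equality
        ∑[ j < 5 ] ∑[ s < 4 ] term j s i i′
          ≡⟨ sum-cong-≗ (λ j → sum-cong-≗ λ s → regroup (e i) (e i′) (eq (seg i j) s) (eq (seg i′ j) s)) ⟩
        ∑[ j < 5 ] ∑[ s < 4 ] (e i * e i′ * (eq (seg i j) s * eq (seg i′ j) s))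
          ≡⟨ sum-cong-≗ (λ j → trans
               (sym (*-distribˡ-sum (e i * e i′) λ s → eq (seg i j) s * eq (seg i′ j) s))
               (cong (e i * e i′ *_) (sum-eq (seg i j) (eq (seg i′ j))))) ⟩
        ∑[ j < 5 ] (e i * e i′ * same i i′ j)
          ≡⟨ *-distribˡ-sum (e i * e i′) (same i i′) ⟨
        e i * e i′ * sum (same i i′) ∎
      same-refl : ∀ i → sum (same i i) ≡ 5
      same-refl i = trans (sum-cong-≗ λ j → eq-refl (seg i j)) (sum-const 5 1)
      five : ∀ {a} b → a ≡ 0 ⊎ a ≡ 1 → b ≡ 5 → a * a + 1 * (4 * a) ≤ a * a * b
      five _ (inj₁ refl) _    = z≤n
      five _ (inj₂ refl) refl = ℕ.≤-refl
      boolean : ∀ {k} (i j : Fin k) → eq i j ≡ 0 ⊎ eq i j ≡ 1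
      boolean i j with i Fin.≟ j
      ... | yes _ = inj₂ refl
      ... | no  _ = inj₁ refl
      once : ∀ {a b} t → a ≡ 0 ⊎ a ≡ 1 → b ≡ 0 ⊎ b ≡ 1 → (a ≡ 1 → b ≡ 1 → 1 ≤ t) →
             a * b + 0 * (4 * b) ≤ a * b * t
      once t (inj₁ refl) _           _ = z≤n
      once t (inj₂ refl) (inj₁ refl) _ = z≤n
      once t (inj₂ refl) (inj₂ refl) h = ℕ.≤-trans (h refl refl) (ℕ.≤-reflexive (sym (ℕ.*-identityˡ t)))
      pair : ∀ i i′ → e i * e i′ + eq i i′ * (4 * e i′) ≤ ∑[ j < 5 ] ∑[ s < 4 ] term j s i i′
      pair i i′ = ℕ.≤-trans (by-cases (i Fin.≟ i′)) (ℕ.≤-reflexive (sym (collapse i i′)))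
        where
        by-cases : Dec (i ≡ i′) → e i * e i′ + eq i i′ * (4 * e i′) ≤ e i * e i′ * sum (same i i′)
        by-cases (yes refl) = subst (λ b → e i * e i + b * (4 * e i) ≤ e i * e i * sum (same i i))
          (sym (eq-refl i)) (five (sum (same i i)) (boolean (cls i) x) (same-refl i))
        by-cases (no i≢i′) = subst (λ b → e i * e i′ + b * (4 * e i′) ≤ e i * e i′ * sum (same i i′))
          (sym (eq-≢ i≢i′)) (once (sum (same i i′)) (boolean (cls i) x) (boolean (cls i′) x) some)
          where
          some : e i ≡ 1 → e i′ ≡ 1 → 1 ≤ sum (same i i′)
          some p q with agree i i′ i≢i′ (trans (eq≡1⇒≡ p) (sym (eq≡1⇒≡ q)))
          ... | j , seg≡ = ℕ.≤-trans (ℕ.≤-reflexive (sym (trans (cong (eq (seg i′ j)) seg≡) (eq-refl (seg i′ j)))))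
                             (term≤sum (same i i′) j)

  squares : Vector ℕ 4 → ℕ
  squares n = ∑[ s < 4 ] (n s * n s)

  Doubled : Vector ℕ 4 → Set
  Doubled n = ∀ s → n s ≡ 0 ⊎ n s ≡ 2

  -- One case for each partition of 4 or 3 points over the segments, with a largest segment `s`.
  -- Given `z = n s - 1`, the bounds on `Q` read `4 + 3 z`, one more for the pattern 2+2, and
  -- `3 + 2 z`. The pattern 2+1+1 has `Q` equal to 6, relaxed to 7 to fit.
  Pattern₄ Pattern₃ : Vector ℕ 4 → ℕ → Set
  Pattern₄ n Q = ∃ λ s → n s ≡ 4 ⊎ (n s ≡ 3 × Q ≤ 10) ⊎ (n s ≡ 2 × Q ≤ 7) ⊎
                         (n s ≡ 2 × Q ≤ 8 × Doubled n) ⊎ (n s ≡ 1 × Q ≤ 4)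
  Pattern₃ n Q = ∃ λ s → n s ≡ 3 ⊎ (n s ≡ 2 × Q ≤ 5) ⊎ (n s ≡ 1 × Q ≤ 3)

  patterns : ∀ {a} → a < 5 → ∀ {b} → b < 5 → ∀ {c} → c < 5 → ∀ {d} → d < 5 →
    let n = lookup (a ∷ b ∷ c ∷ d ∷ []) in
    (sum n ≡ 4 → Pattern₄ n (squares n)) × (sum n ≡ 3 → Pattern₃ n (squares n))
  patterns = from-yes
    (ℕ.allUpTo? (λ a → ℕ.allUpTo? (λ b → ℕ.allUpTo? (λ c → ℕ.allUpTo? (λ d →
      let n = lookup (a ∷ b ∷ c ∷ d ∷ []) in pattern₄? n ×-dec pattern₃? n) 5) 5) 5) 5)
    where
    pattern₄? : ∀ n → Dec (sum n ≡ 4 → Pattern₄ n (squares n))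
    pattern₄? n = (_ ℕ.≟ _) →-dec (Fin.any? λ s → (_ ℕ.≟ _) ⊎-dec ((_ ℕ.≟ _) ×-dec (_ ℕ.≤? _)) ⊎-dec
      ((_ ℕ.≟ _) ×-dec (_ ℕ.≤? _)) ⊎-dec ((_ ℕ.≟ _) ×-dec (_ ℕ.≤? _) ×-dec
        (Fin.all? λ s → (_ ℕ.≟ _) ⊎-dec (_ ℕ.≟ _))) ⊎-dec ((_ ℕ.≟ _) ×-dec (_ ℕ.≤? _)))
    pattern₃? : ∀ n → Dec (sum n ≡ 3 → Pattern₃ n (squares n))
    pattern₃? n = (_ ℕ.≟ _) →-dec (Fin.any? λ s → (_ ℕ.≟ _) ⊎-dec
      ((_ ℕ.≟ _) ×-dec (_ ℕ.≤? _)) ⊎-dec ((_ ℕ.≟ _) ×-dec (_ ℕ.≤? _)))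

  private
    table : Vector ℕ 4 → Vector ℕ 4
    table n = lookup (tabulate n)

    at : ∀ n s → table n s ≡ n s
    at = Vec.lookup∘tabulate

    entry<5 : ∀ (n : Vector ℕ 4) {k} → sum n ≡ k → k ≤ 4 → ∀ s → n s < 5
    entry<5 n e k≤4 s = s≤s (ℕ.≤-trans (term≤sum n s) (ℕ.≤-trans (ℕ.≤-reflexive e) k≤4))

  pattern₄ : ∀ n → sum n ≡ 4 → Pattern₄ n (squares n)
  pattern₄ n e = transfer (proj₁ (patterns (<5 zero) (<5 (suc zero)) (<5 (suc (suc zero)))
                                           (<5 (suc (suc (suc zero))))) (trans (sum-cong-≗ (at n)) e))
    where
    <5 = entry<5 n e ℕ.≤-refl
    transfer : Pattern₄ (table n) (squares (table n)) → Pattern₄ n (squares n)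
    transfer (s , p) rewrite at n s | sum-cong-≗ (λ s → cong₂ _*_ (at n s) (at n s)) = s , doubled p
      where
      doubled : _ ⊎ _ ⊎ _ ⊎ (_ × _ × Doubled (table n)) ⊎ _ → _
      doubled (inj₁ p) = inj₁ p
      doubled (inj₂ (inj₁ p)) = inj₂ (inj₁ p)
      doubled (inj₂ (inj₂ (inj₁ p))) = inj₂ (inj₂ (inj₁ p))
      doubled (inj₂ (inj₂ (inj₂ (inj₁ (p , q , r))))) =
        inj₂ (inj₂ (inj₂ (inj₁ (p , q , λ s → subst (λ a → a ≡ 0 ⊎ a ≡ 2) (at n s) (r s)))))
      doubled (inj₂ (inj₂ (inj₂ (inj₂ p)))) = inj₂ (inj₂ (inj₂ (inj₂ p)))

  pattern₃ : ∀ n → sum n ≡ 3 → Pattern₃ n (squares n)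
  pattern₃ n e = transfer (proj₂ (patterns (<5 zero) (<5 (suc zero)) (<5 (suc (suc zero)))
                                           (<5 (suc (suc (suc zero))))) (trans (sum-cong-≗ (at n)) e))
    where
    <5 = entry<5 n e (ℕ.n≤1+n 3)
    transfer : Pattern₃ (table n) (squares (table n)) → Pattern₃ n (squares n)
    transfer (s , p) rewrite at n s | sum-cong-≗ (λ s → cong₂ _*_ (at n s) (at n s)) = s , p

  maximum : ∀ {d} (f : Vector ℕ (suc d)) → ∃ λ s → ∀ t → f t ≤ f s
  maximum {zero}  f = zero , λ { zero → ℕ.≤-refl }
  maximum {suc d} f with maximum (λ s → f (suc s))
  ... | s , top with ℕ.≤-total (f zero) (f (suc s))
  ...   | inj₁ f₀≤ = suc s , λ { zero → f₀≤ ; (suc t) → top t }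
  ...   | inj₂ ≤f₀ = zero , λ { zero → ℕ.≤-refl ; (suc t) → ℕ.≤-trans (top t) ≤f₀ }

  other : ∀ (k : Fin 5) → ∃ λ l → k ≢ l
  other zero    = suc zero , λ ()
  other (suc _) = zero , λ ()


  -- Excluding an arc of 69 points

  module Arc {N : ℕ} (c : Fin 21 → Fin 5 → Fin N → Fin 4)
    (orthogonal : ∀ m j k → j ≢ k → ∀ s t → ∑[ q < N ] (eq (c m j q) s * eq (c m k q) t) ≡ 1)
    (n : Fin 21 → Fin 5 → Fin 4 → ℕ) (w : Fin 21 → ℕ)
    (partition : ∀ x j → sum (n x j) ≡ w x)
    (total : sum w ≡ 69)
    (agreements : ∀ x → w x * w x + 4 * w x ≤ ∑[ j < 5 ] squares (n x j))
    (bound : ∀ m q → ∑[ k < 5 ] n (pt m k) k (c m k q) ≤ 5) where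

    private
      module Class m = Net (c m) other (orthogonal m)
      module W = Weighted w

      row : Fin 21 → Fin 5 → Fin 4 → ℕ
      row m k = n (pt m k) k

    segment-bound : ∀ x j s → 4 * n x j s + W.D (ln x j) ≤ 20 + w x
    segment-bound x j s = subst (λ y → 4 * n y j s + W.D (ln x j) ≤ 20 + w y) (pt-ln x j)
      (subst₂ (λ a b → 4 * row (ln x j) j s + a ≤ 20 + b)
        (sum-cong-≗ λ k → partition (pt (ln x j) k) k) (partition (pt (ln x j) j) j)
        (Class.segment-bound (ln x j) (row (ln x j)) (bound (ln x j)) j s))

    pencil-weight : ∀ x → ∑[ j < 5 ] W.D (ln x j) ≡ 69 + 4 * w x
    pencil-weight x = trans (W.pencil x) (cong (λ a → a + 4 * w x) {x = sum w} {y = 69} total)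

    fullest : ∀ x j → ∃ λ t → w x ≤ 4 * t × 4 * t + W.D (ln x j) ≤ 20 + w x
    fullest x j = let s , top = maximum (n x j) in
      n x j s , subst₂ _≤_ (partition x j) (sum-const 4 (n x j s)) (sum-mono top) , segment-bound x j s

    -- Let `t j` be the largest segment in direction `j`. Summing the segment bounds over the pencil
    -- gives `4 Σt ≤ 31 + w`. If `w > 4`, then every `t j` is at least 2, which forces `w ≥ 9`; but
    -- `w ≤ 4 * t j` in all five directions gives `4 w ≤ 31`.
    w≤4 : ∀ x → w x ≤ 4
    w≤4 x = few (λ j → proj₁ (fullest x j)) (λ j → proj₁ (proj₂ (fullest x j))) (λ j → proj₂ (proj₂ (fullest x j)))
      where
      few : (t : Fin 5 → ℕ) → (∀ j → w x ≤ 4 * t j) → (∀ j → 4 * t j + W.D (ln x j) ≤ 20 + w x) → w x ≤ 4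
      few t w≤4t segment = ℕ.≮⇒≥ λ 4<w → ℕ.<⇒≱ (8≤w 4<w) w≤7
        where
        combined : 4 * sum t + (69 + 4 * w x) ≤ 100 + 5 * w x
        combined = subst₂ _≤_
          (trans (∑-distrib-+ (λ j → 4 * t j) (λ j → W.D (ln x j)))
            (cong₂ _+_ (sym (*-distribˡ-sum 4 t)) (pencil-weight x)))
          (trans (sum-const 5 (20 + w x)) (ℕ.*-distribˡ-+ 5 20 (w x)))
          (sum-mono segment)
        Σt≤ : 4 * sum t ≤ 31 + w x
        Σt≤ = linear 0 combined (identity (sum t) (w x))
          where
          identity : ∀ t w → 4 * t + (100 + 5 * w) + 0 ≡ 31 + w + (4 * t + (69 + 4 * w))
          identity = solve-∀
        8≤w : 4 < w x → 8 ≤ w x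
        8≤w 4<w = ℕ.≤-trans (ℕ.n≤1+n 8) (linear 0 (Σt≤ +≤ 4 *≤ 10≤) (identity (sum t) (w x)))
          where
          10≤ : 10 ≤ sum t
          10≤ = subst (_≤ sum t) (sum-const 5 2)
            (sum-mono λ j → ℕ.*-cancelˡ-< 4 1 (t j) (ℕ.≤-trans 4<w (w≤4t j)))
          identity : ∀ t w → 9 + (31 + w + 4 * t) + 0 ≡ w + (4 * t + 40)
          identity = solve-∀
        w≤7 : w x ≤ 7
        w≤7 = s≤s⁻¹ (ℕ.*-cancelˡ-< 4 (w x) 8 (s≤s (linear 0 (Σt≤ +≤ 5w≤) (identity (sum t) (w x)))))
          where
          5w≤ : 5 * w x ≤ 4 * sum t
          5w≤ = subst₂ _≤_ (sum-const 5 (w x)) (sym (*-distribˡ-sum 4 t)) (sum-mono w≤4t)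
          identity : ∀ t w → 4 * w + (31 + w + 4 * t) + 0 ≡ 31 + (4 * t + 5 * w)
          identity = solve-∀

    -- Deficits of point classes and lines

    δ : Fin 21 → ℕ
    δ x = 4 ∸ w x

    w+δ : ∀ x → w x + δ x ≡ 4
    w+δ x = ℕ.m+[n∸m]≡n (w≤4 x)

    open Weighted δ using (D)
    private module Δ = Weighted δ

    δ≤4 : ∀ x → δ x ≤ 4
    δ≤4 x = ℕ.m∸n≤m 4 (w x)

    total-deficit : sum δ ≡ 15
    total-deficit = ℕ.+-cancelˡ-≡ 69 (sum δ) 15 (trans
      (cong (λ a → a + sum δ) {x = 69} {y = sum w} (sym total))
      (trans (sym (∑-distrib-+ w δ)) (trans (sum-cong-≗ w+δ) (sum-const 21 4))))

    W+D : ∀ m → W.D m + D m ≡ 20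
    W+D m = trans (sym (∑-distrib-+ (λ k → w (pt m k)) (λ k → δ (pt m k))))
      (trans (sum-cong-≗ λ k → w+δ (pt m k)) (sum-const 5 4))

    pencil : ∀ x → ∑[ j < 5 ] D (ln x j) ≡ 15 + 4 * δ x
    pencil x = trans (Δ.pencil x) (cong (λ a → a + 4 * δ x) {x = sum δ} {y = 15} total-deficit)

    -- The segment bound rewritten with `w = 4 - δ` and with `W.D = 20 - D`.
    deficit-bound : ∀ x j s → 4 * n x j s + δ x ≤ D (ln x j) + 4
    deficit-bound x j s = linear 0
      (segment-bound x j s +≤ ℕ.≤-reflexive (w+δ x) +≤ ℕ.≤-reflexive (sym (W+D (ln x j))))
      (identity (n x j s) (δ x) (w x) (W.D (ln x j)) (D (ln x j)))
      where
      identity : ∀ n δ w W D → 4 * n + δ + (20 + w + (4 + (W + D))) + 0 ≡ D + 4 + (4 * n + W + (w + δ + 20))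
      identity = solve-∀

    above : ∀ x j {s k} → n x j s ≡ suc k → 4 * k + δ x ≤ D (ln x j)
    above x j {s} {k} n≡ = linear 0
      (subst (λ a → 4 * a + δ x ≤ D (ln x j) + 4) n≡ (deficit-bound x j s)) (identity k (δ x) (D (ln x j)))
      where
      identity : ∀ k δ D → 4 * k + δ + (D + 4) + 0 ≡ D + (4 * suc k + δ)
      identity = solve-∀

    -- The alternative to a segment with four points: g marks the directions in which the
    -- class meets two segments in two points each.
    record Balanced (x : Fin 21) : Set where
      field
        g       : Fin 5 → ℕ
        three   : 3 ≤ sum g
        heavy   : ∀ j → 4 * g j ≤ D (ln x j)
        doubled : ∀ j → g j ≡ 0 ⊎ (g j ≡ 1 × Doubled (n x j))

    -- Let `z j` be one less than the largest segment in direction `j`. Then `4 * z j ≤ D`, and the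
    -- pencil sum 15 leaves `Σz ≤ 3`. Pair counting requires squares of total at least 32, while
    -- direction `j` supplies at most `4 + 3 * z j + g j`. Hence `Σg ≥ 3`.
    full-class : ∀ x → δ x ≡ 0 → (∃ λ j → 12 ≤ D (ln x j)) ⊎ Balanced x
    full-class x δ≡0 with Fin.any? (λ j → 12 ℕ.≤? D (ln x j))
    ... | yes long = inj₁ long
    ... | no short = inj₂ (balanced λ j → flag j (pattern₄ (n x j) (trans (partition x j) w≡4)))
      where
      w≡4 : w x ≡ 4
      w≡4 = trans (sym (ℕ.+-identityʳ (w x))) (trans (cong (w x +_) (sym δ≡0)) (w+δ x))

      Flag : Fin 5 → Set
      Flag j = ∃₂ λ z g → 4 * z ≤ D (ln x j) × squares (n x j) ≤ 4 + 3 * z + g ×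
                          4 * g ≤ D (ln x j) × (g ≡ 0 ⊎ (g ≡ 1 × Doubled (n x j)))

      lower : ∀ j {s k} → n x j s ≡ suc k → 4 * k ≤ D (ln x j)
      lower j {k = k} n≡ = ℕ.≤-trans (ℕ.m≤m+n (4 * k) (δ x)) (above x j n≡)

      flag : ∀ j → Pattern₄ (n x j) (squares (n x j)) → Flag j
      flag j (s , inj₁ n≡4) = contradiction (j , lower j n≡4) short
      flag j (s , inj₂ (inj₁ (n≡3 , Q≤))) = 2 , 0 , lower j n≡3 , Q≤ , z≤n , inj₁ refl
      flag j (s , inj₂ (inj₂ (inj₁ (n≡2 , Q≤)))) = 1 , 0 , lower j n≡2 , Q≤ , z≤n , inj₁ refl
      flag j (s , inj₂ (inj₂ (inj₂ (inj₁ (n≡2 , Q≤ , dbl))))) =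
        1 , 1 , lower j n≡2 , Q≤ , lower j n≡2 , inj₂ (refl , dbl)
      flag j (s , inj₂ (inj₂ (inj₂ (inj₂ (n≡1 , Q≤))))) = 0 , 0 , z≤n , Q≤ , z≤n , inj₁ refl

      balanced : (∀ j → Flag j) → Balanced x
      balanced flags = record
        { g = g
        ; three = linear 0 (Q-lower +≤ Q-upper +≤ 3 *≤ z≤3) (identity (sum Q) (sum z) (sum g))
        ; heavy = λ j → proj₁ (proj₂ (proj₂ (proj₂ (proj₂ (flags j)))))
        ; doubled = λ j → proj₂ (proj₂ (proj₂ (proj₂ (proj₂ (flags j)))))
        }
        where
        z g Q : Fin 5 → ℕ
        z j = proj₁ (flags j)
        g j = proj₁ (proj₂ (flags j))
        Q j = squares (n x j)
        Q-lower : 32 ≤ sum Q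
        Q-lower = subst (λ a → a * a + 4 * a ≤ sum Q) w≡4 (agreements x)
        Q-upper : sum Q ≤ 20 + 3 * sum z + sum g
        Q-upper = subst (sum Q ≤_)
          (trans (∑-distrib-+ (λ j → 4 + 3 * z j) g) (cong (_+ sum g)
            (trans (∑-distrib-+ (λ _ → 4) (λ j → 3 * z j))
              (cong₂ _+_ (sum-const 5 4) (sym (*-distribˡ-sum 3 z))))))
          (sum-mono λ j → proj₁ (proj₂ (proj₂ (proj₂ (flags j)))))
        z≤3 : sum z ≤ 3
        z≤3 = s≤s⁻¹ (ℕ.*-cancelˡ-< 4 (sum z) 4 (s≤s (subst₂ _≤_ (sym (*-distribˡ-sum 4 z))
          (trans (pencil x) (cong (λ a → 15 + 4 * a) δ≡0)) (sum-mono λ j → proj₁ (proj₂ (proj₂ (flags j)))))))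
        identity : ∀ Q z g → 3 + (Q + (20 + 3 * z + g + 3 * 3)) + 0 ≡ g + (32 + (Q + 3 * z))
        identity = solve-∀

    -- The marked directions already use 12 of the pencil sum 15, so an unmarked one cannot take 4
    -- more.
    heavy⇒doubled : ∀ {x} → δ x ≡ 0 → Balanced x → ∀ j → 4 ≤ D (ln x j) → Doubled (n x j)
    heavy⇒doubled {x} δ≡0 balanced j 4≤D with Balanced.doubled balanced j
    ... | inj₂ (_ , dbl) = dbl
    ... | inj₁ gj≡0 = ⊥-elim (ℕ.<⇒≱ {15} {16} ℕ.≤-refl (linear 0 (4 *≤ three +≤ Σ≤) (identity (sum g))))
      where
      open Balanced balanced
      pointwise : ∀ k → 4 * g k + eq j k * 4 ≤ D (ln x k)
      pointwise k with j Fin.≟ k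
      ... | yes refl rewrite gj≡0 = 4≤D
      ... | no  _ = subst (_≤ D (ln x k)) (sym (ℕ.+-identityʳ (4 * g k))) (heavy k)
      Σ≤ : 4 * sum g + 4 ≤ 15
      Σ≤ = subst₂ _≤_
        (trans (∑-distrib-+ (λ k → 4 * g k) (λ k → eq j k * 4))
          (cong₂ _+_ (sym (*-distribˡ-sum 4 g)) (sum-eq j λ _ → 4)))
        (trans (pencil x) (cong (λ a → 15 + 4 * a) δ≡0)) (sum-mono pointwise)
      identity : ∀ g → 16 + (4 * g + 15) + 0 ≡ 15 + (4 * 3 + (4 * g + 4))
      identity = solve-∀

    -- If no segment has three points, pair counting gives `21 ≤ 15 + 2 Σz`, so `Σz ≥ 3`. The lower
    -- bounds `1 + 4 * z j` then use at least 17 of the pencil sum 19. A line with `D = 4` has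
    -- `z = 0` and exceeds its lower bound by 3, which is more than the remaining 2.
    deficient-class : ∀ x → δ x ≡ 1 → (∃ λ j → 9 ≤ D (ln x j)) ⊎ (∀ j → D (ln x j) ≢ 4)
    deficient-class x δ≡1 with Fin.any? (λ j → 9 ℕ.≤? D (ln x j))
    ... | yes long = inj₁ long
    ... | no short = inj₂ (impossible λ j → flag j (pattern₃ (n x j) (trans (partition x j) w≡3)))
      where
      w≡3 : w x ≡ 3
      w≡3 = ℕ.+-cancelʳ-≡ 1 (w x) 3 (trans (cong (w x +_) (sym δ≡1)) (w+δ x))

      Flag : Fin 5 → Set
      Flag j = ∃ λ z → 1 + 4 * z ≤ D (ln x j) × squares (n x j) ≤ 3 + 2 * z

      lower : ∀ j {s k} → n x j s ≡ suc k → 1 + 4 * k ≤ D (ln x j)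
      lower j {k = k} n≡ = subst (_≤ D (ln x j)) (trans (cong (4 * k +_) δ≡1) (ℕ.+-comm (4 * k) 1)) (above x j n≡)

      flag : ∀ j → Pattern₃ (n x j) (squares (n x j)) → Flag j
      flag j (s , inj₁ n≡3) = contradiction (j , lower j n≡3) short
      flag j (s , inj₂ (inj₁ (n≡2 , Q≤))) = 1 , lower j n≡2 , Q≤
      flag j (s , inj₂ (inj₂ (n≡1 , Q≤))) = 0 , lower j n≡1 , Q≤

      impossible : (∀ j → Flag j) → ∀ i → D (ln x i) ≢ 4
      impossible flags i D≡4 = ℕ.<⇒≱ {19} {20} ℕ.≤-refl
        (linear 0 (2 *≤ (Q-lower +≤ Q-upper) +≤ Σ≤) (identity (sum Q) (sum z)))
        where
        z Q : Fin 5 → ℕ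
        z j = proj₁ (flags j)
        Q j = squares (n x j)
        Q-lower : 21 ≤ sum Q
        Q-lower = subst (λ a → a * a + 4 * a ≤ sum Q) w≡3 (agreements x)
        Q-upper : sum Q ≤ 15 + 2 * sum z
        Q-upper = subst (sum Q ≤_)
          (trans (∑-distrib-+ (λ _ → 3) (λ j → 2 * z j))
            (cong₂ _+_ (sum-const 5 3) (sym (*-distribˡ-sum 2 z))))
          (sum-mono λ j → proj₂ (proj₂ (flags j)))
        zi≡0 : z i ≡ 0
        zi≡0 = ℕ.n<1⇒n≡0 (ℕ.*-cancelˡ-< 4 (z i) 1 (subst (suc (4 * z i) ≤_) D≡4 (proj₁ (proj₂ (flags i)))))
        pointwise : ∀ k → (1 + 4 * z k) + eq i k * 3 ≤ D (ln x k)
        pointwise k with i Fin.≟ k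
        ... | yes refl rewrite zi≡0 | D≡4 = ℕ.≤-refl
        ... | no  _ = subst (_≤ D (ln x k)) (sym (ℕ.+-identityʳ (1 + 4 * z k))) (proj₁ (proj₂ (flags k)))
        Σ≤ : 5 + 4 * sum z + 3 ≤ 19
        Σ≤ = subst₂ _≤_
          (trans (∑-distrib-+ (λ k → 1 + 4 * z k) (λ k → eq i k * 3))
            (cong₂ _+_ (trans (∑-distrib-+ (λ _ → 1) (λ k → 4 * z k))
              (cong₂ _+_ (sum-const 5 1) (sym (*-distribˡ-sum 4 z)))) (sum-eq i λ _ → 3)))
          (trans (pencil x) (cong (λ a → 15 + 4 * a) δ≡1)) (sum-mono pointwise)
        identity : ∀ Q z → 20 + (2 * (Q + (15 + 2 * z)) + 19) + 0 ≡ 19 + (2 * (21 + Q) + (5 + 4 * z + 3))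
        identity = solve-∀

    shared≤4 : ∀ {a b} → a ≢ b → Δ.shared a b ≤ 4
    shared≤4 {a} {b} a≢b = let j , k , meet = lines-meet a b in
      subst (_≤ 4) (sym (Δ.shared-meet j k a≢b meet)) (δ≤4 (pt a j))

    crossing : ∀ {a b} → a ≢ b → D a + D b ≤ 19
    crossing {a} {b} a≢b = ℕ.≤-trans (Δ.two-lines a b)
      (ℕ.+-mono-≤ (ℕ.≤-reflexive total-deficit) (shared≤4 a≢b))

    -- Two classes of deficit 1 on a line of deficit 4 would lie on two further lines of
    -- deficit at least 9, and the three lines together exceed the total deficit 15.
    single-deficient : ∀ m → D m ≡ 4 → ∀ j k → δ (pt m j) ≡ 1 → δ (pt m k) ≡ 1 → j ≡ k
    single-deficient m D≡4 j k δj≡1 δk≡1 with j Fin.≟ k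
    ... | yes j≡k = j≡k
    ... | no j≢k = ⊥-elim (triangle (long j δj≡1) (long k δk≡1))
      where
      long : ∀ k → δ (pt m k) ≡ 1 → ∃ λ i → 9 ≤ D (ln (pt m k) i)
      long k δ≡1 with deficient-class (pt m k) δ≡1
      ... | inj₁ l = l
      ... | inj₂ h = contradiction (trans (cong D (ln-pt m k)) D≡4) (h k)
      differ : ∀ {a} → 9 ≤ D a → a ≢ m
      differ 9≤D refl = ℕ.<⇒≱ {8} {9} ℕ.≤-refl (ℕ.≤-trans 9≤D (ℕ.≤-trans (ℕ.≤-reflexive D≡4) (ℕ.m≤m+n 4 4)))
      meet : ∀ {x} i k → x ≡ pt m k → pt (ln x i) i ≡ pt m k
      meet i k refl = pt-ln _ i
      triangle : (∃ λ i → 9 ≤ D (ln (pt m j) i)) → (∃ λ i → 9 ≤ D (ln (pt m k) i)) → ⊥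
      triangle (i , 9≤a) (i′ , 9≤b) = ℕ.<⇒≱ {21} {22} ℕ.≤-refl (begin
        9 + 9 + 4
          ≤⟨ ℕ.+-mono-≤ (ℕ.+-mono-≤ 9≤a 9≤b) (ℕ.≤-reflexive (sym D≡4)) ⟩
        D a + D b + D m
          ≤⟨ Δ.three-lines a b m ⟩
        sum δ + Δ.shared a b + Δ.shared a m + Δ.shared b m
          ≤⟨ ℕ.+-mono-≤ (ℕ.+-mono-≤ (ℕ.+-mono-≤ (ℕ.≤-reflexive total-deficit) (shared≤4 a≢b))
               (ℕ.≤-reflexive (at-one {a} (differ 9≤a) i j a∩m δj≡1)))
               (ℕ.≤-reflexive (at-one {b} (differ 9≤b) i′ k b∩m δk≡1)) ⟩
        15 + 4 + 1 + 1 ∎)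
        where
        open ℕ.≤-Reasoning
        a b : Fin 21
        a = ln (pt m j) i
        b = ln (pt m k) i′
        a∩m : pt a i ≡ pt m j
        a∩m = pt-ln (pt m j) i
        b∩m : pt b i′ ≡ pt m k
        b∩m = pt-ln (pt m k) i′
        at-one : ∀ {l} → l ≢ m → ∀ i k → pt l i ≡ pt m k → δ (pt m k) ≡ 1 → Δ.shared l m ≡ 1
        at-one l≢m i k e δ≡1 = trans (Δ.shared-meet i k l≢m e) (trans (cong δ e) δ≡1)
        a≢b : a ≢ b
        a≢b a≡b = j≢k (pt-injective m j k (trans (sym a∩m) (trans
          (meet-once (differ 9≤a) a∩m (subst (λ l → pt l i′ ≡ pt m k) (sym a≡b) b∩m))
          (subst (λ l → pt l i′ ≡ pt m k) (sym a≡b) b∩m))))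

    no-line-4 : ∀ m → D m ≢ 4
    no-line-4 m D≡4 = no-deficit-4 (c m) other (orthogonal m) (row m) (λ k → δ (pt m k))
      (λ k → trans (cong (_+ δ (pt m k)) (partition (pt m k) k)) (w+δ (pt m k)))
      D≡4 (bound m) doubled flat (single-deficient m D≡4)
      where
      D≡4-at : ∀ k → D (ln (pt m k) k) ≡ 4
      D≡4-at k = trans (cong D (ln-pt m k)) D≡4
      doubled : ∀ k → δ (pt m k) ≡ 0 → Doubled (row m k)
      doubled k δ≡0 with full-class (pt m k) δ≡0
      ... | inj₂ balanced = heavy⇒doubled δ≡0 balanced k (ℕ.≤-reflexive (sym (D≡4-at k)))
      -- A line with `D ≥ 12` through a full class of this line would leave at most 3 of the pencil
      -- sum 15 for the line itself.
      ... | inj₁ (j , 12≤D) = ⊥-elim (ℕ.<⇒≱ {15} {16} ℕ.≤-refl (begin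
        12 + 4                                       ≤⟨ ℕ.+-mono-≤ 12≤D (ℕ.≤-reflexive (sym (D≡4-at k))) ⟩
        D (ln (pt m k) j) + D (ln (pt m k) k)        ≤⟨ two-terms≤sum (λ i → D (ln (pt m k) i)) j≢k ⟩
        ∑[ i < 5 ] D (ln (pt m k) i)                 ≡⟨ trans (pencil (pt m k)) (cong (λ a → 15 + 4 * a) δ≡0) ⟩
        15                                           ∎))
        where
        open ℕ.≤-Reasoning
        j≢k : j ≢ k
        j≢k refl = ℕ.<⇒≱ {4} {12} (ℕ.m≤m+n 5 7) (ℕ.≤-trans 12≤D (ℕ.≤-reflexive (D≡4-at k)))
      flat : ∀ k → δ (pt m k) ≢ 0 → ∀ s → row m k s ≤ 1
      -- With `D = 4` the deficit bound reads `4 n + δ ≤ 8`, so `δ ≥ 1` excludes `n = 2`.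
      flat k δ≢0 s = s≤s⁻¹ (ℕ.*-cancelˡ-< 4 (row m k s) 2 (ℕ.≤-trans
        (ℕ.≤-trans (ℕ.≤-reflexive (ℕ.+-comm 1 (4 * row m k s))) (ℕ.+-monoʳ-≤ (4 * row m k s) (ℕ.n≢0⇒n>0 δ≢0)))
        (ℕ.≤-trans (deficit-bound (pt m k) k s) (ℕ.≤-reflexive (cong (_+ 4) (D≡4-at k))))))

    -- Since `D = 4` is excluded, `4 * g j ≤ D` improves to `5 * g j ≤ D`. With `Σg ≥ 3` and pencil
    -- sum 15, equality holds in every direction.
    balanced-lines : ∀ {x} → δ x ≡ 0 → Balanced x →
                     (∀ j → D (ln x j) ≡ 0 ⊎ D (ln x j) ≡ 5) × ∃ λ j → D (ln x j) ≡ 0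
    balanced-lines {x} δ≡0 balanced = zero-or-five , some-zero
      where
      open Balanced balanced
      5g≤D : ∀ j → 5 * g j ≤ D (ln x j)
      5g≤D j with doubled j | heavy j
      ... | inj₁ g≡0 | _ rewrite g≡0 = z≤n
      ... | inj₂ (g≡1 , _) | 4g≤D rewrite g≡1 = ℕ.≤∧≢⇒< 4g≤D λ 4≡D → no-line-4 (ln x j) (sym 4≡D)
      ΣD≡15 : ∑[ j < 5 ] D (ln x j) ≡ 15
      ΣD≡15 = trans (pencil x) (cong (λ a → 15 + 4 * a) δ≡0)
      5g≡D : ∀ j → 5 * g j ≡ D (ln x j)
      5g≡D = sum-tight 5g≤D (subst₂ _≤_ (sym ΣD≡15) (*-distribˡ-sum 5 g) (5 *≤ three))
      zero-or-five : ∀ j → D (ln x j) ≡ 0 ⊎ D (ln x j) ≡ 5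
      zero-or-five j with doubled j
      ... | inj₁ g≡0       = inj₁ (trans (sym (5g≡D j)) (cong (5 *_) g≡0))
      ... | inj₂ (g≡1 , _) = inj₂ (trans (sym (5g≡D j)) (cong (5 *_) g≡1))
      some-zero : ∃ λ j → D (ln x j) ≡ 0
      some-zero with Fin.any? (λ j → D (ln x j) ℕ.≟ 0)
      ... | yes z = z
      ... | no ¬z = contradiction (trans (sym ΣD≡15) (trans (sum-cong-≗ five) (sum-const 5 5))) λ ()
        where
        five : ∀ j → D (ln x j) ≡ 5
        five j with zero-or-five j
        ... | inj₁ z = contradiction (j , z) ¬z
        ... | inj₂ f = f

    -- The contradiction in a pencil

    point≤line : ∀ x j → δ x ≤ D (ln x j)
    point≤line x j = subst (λ y → δ y ≤ D (ln x j)) (pt-ln x j) (term≤sum (λ k → δ (pt (ln x j) k)) j)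

    deficit-5 : ∀ m k → 1 ≤ D m → δ (pt m k) ≡ 0 → Balanced (pt m k) → D m ≡ 5
    deficit-5 m k 1≤D δ≡0 balanced with proj₁ (balanced-lines δ≡0 balanced) k
    ... | inj₁ z = contradiction (ℕ.≤-trans 1≤D (ℕ.≤-reflexive (trans (cong D (sym (ln-pt m k))) z))) λ ()
    ... | inj₂ f = trans (cong D (sym (ln-pt m k))) f

    -- A full class `x` exists because 21 classes share deficit 15, and it lies on a line of deficit
    -- 0. Every line through a class `z` of positive deficit meets that line in a full, hence
    -- balanced, class and so has `D = 5`. But `25 = 15 + 4 δ(z)` has no solution.
    without-long-line : (∀ m → ¬ 12 ≤ D m) → ⊥
    without-long-line short with Fin.any? (λ x → δ x ℕ.≟ 0)
    ... | no ∄ = ℕ.<⇒≱ {15} {21} (ℕ.m≤m+n 16 5) (subst₂ _≤_ (sum-const 21 1) total-deficit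
                   (sum-mono λ x → ℕ.n≢0⇒n>0 λ δ≡0 → ∄ (x , δ≡0)))
    ... | yes (x , δx≡0) with Fin.any? (λ z → 1 ℕ.≤? δ z)
    ...   | no ∄ = contradiction
      (trans (sym total-deficit) (sum-zero {f = δ} λ z → ℕ.n<1⇒n≡0 (ℕ.≰⇒> λ 1≤δ → ∄ (z , 1≤δ)))) λ ()
    ...   | yes (z , 1≤δz) = uneven (δ z) (δ≤4 z) (trans (sym (pencil z)) (trans (sum-cong-≗ five) (sum-const 5 5)))
      where
      all-balanced : ∀ y → δ y ≡ 0 → Balanced y
      all-balanced y δ≡0 with full-class y δ≡0
      ... | inj₁ (j , 12≤D) = ⊥-elim (short (ln y j) 12≤D)
      ... | inj₂ balanced = balanced
      uneven : ∀ d → d ≤ 4 → 15 + 4 * d ≢ 25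
      uneven 0 _ ()
      uneven 1 _ ()
      uneven 2 _ ()
      uneven 3 _ ()
      uneven 4 _ ()
      uneven (suc (suc (suc (suc (suc _))))) (s≤s (s≤s (s≤s (s≤s ())))) _
      empty : ∃ λ j → D (ln x j) ≡ 0
      empty = proj₂ (balanced-lines δx≡0 (all-balanced x δx≡0))
      five : ∀ j → D (ln z j) ≡ 5
      five j with lines-meet (ln z j) (ln x (proj₁ empty))
      ... | a , b , meet = deficit-5 (ln z j) a (ℕ.≤-trans 1≤δz (point≤line z j)) δ≡0 (all-balanced _ δ≡0)
        where
        δ≡0 : δ (pt (ln z j) a) ≡ 0
        δ≡0 = ℕ.n≤0⇒n≡0 (subst₂ _≤_ (cong δ (sym meet)) (proj₂ empty)
                (term≤sum (λ k → δ (pt (ln x (proj₁ empty)) k)) b))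

    -- Take `y` on `ℓ` with positive deficit. The other four lines through `y` have `D = 5`, so the
    -- pencil sum gives `20 + D ℓ = 15 + 4 δ(y) ≤ 31`. The computation below adds 5 to both sides to
    -- let all five directions contribute a 5.
    with-long-line : ∀ ℓ → 12 ≤ D ℓ → ⊥
    with-long-line ℓ 12≤D with Fin.any? (λ k → 1 ℕ.≤? δ (pt ℓ k))
    ... | no ∄ = contradiction (ℕ.≤-trans 12≤D (ℕ.≤-reflexive
                   (sum-zero {f = λ k → δ (pt ℓ k)} λ k → ℕ.n<1⇒n≡0 (ℕ.≰⇒> λ 1≤δ → ∄ (k , 1≤δ))))) λ ()
    ... | yes (k , 1≤δ) = ℕ.<⇒≱ {36} {37} ℕ.≤-refl (begin
        25 + 12                                   ≤⟨ ℕ.+-monoʳ-≤ 25 12≤D ⟩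
        25 + D ℓ                                  ≡⟨ Σ≡ ⟨
        15 + 4 * δ y + 5                          ≤⟨ ℕ.+-monoˡ-≤ 5 (ℕ.+-monoʳ-≤ 15 (4 *≤ δ≤4 y)) ⟩
        36                                        ∎)
      where
      open ℕ.≤-Reasoning
      y : Fin 21
      y = pt ℓ k
      ln-y : ln y k ≡ ℓ
      ln-y = ln-pt ℓ k
      transversal : ∀ j → j ≢ k → ln y j ≢ ℓ
      transversal j j≢k e = j≢k (ln-injective y j k (trans e (sym ln-y)))

      five : ∀ j → j ≢ k → D (ln y j) ≡ 5
      five j j≢k with Fin.any? (λ i → δ (pt (ln y j) i) ℕ.≟ 0)
      ... | yes (i , δ≡0) = on-full (full-class (pt t i) δ≡0)
        where
        t : Fin 21
        t = ln y j
        -- The lines `t` and `ℓ` meet only in `y`, which has positive deficit, so a full class on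
        -- `t` is off `ℓ`.
        apart : ∀ l → ln (pt t i) l ≢ ℓ
        apart l e = ℕ.<⇒≱ 1≤δ (ℕ.≤-reflexive (trans (cong δ (trans (sym (pt-ln y j)) (meet-once
          (transversal j j≢k) (pt-ln y j)
          (trans (sym (pt-ln (pt t i) l)) (cong (λ a → pt a l) e))))) δ≡0))
        on-full : (∃ λ l → 12 ≤ D (ln (pt t i) l)) ⊎ Balanced (pt t i) → D t ≡ 5
        on-full (inj₂ balanced) = deficit-5 t i (ℕ.≤-trans 1≤δ (point≤line y j)) δ≡0 balanced
        -- Two distinct lines have total deficit at most `15 + 4`, so a second line with `D ≥ 12` is
        -- impossible.
        on-full (inj₁ (l , 12≤D′)) = ⊥-elim (ℕ.<⇒≱ {19} {24} (ℕ.m≤m+n 20 4)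
          (ℕ.≤-trans (ℕ.+-mono-≤ 12≤D′ 12≤D) (crossing (apart l))))
      -- If `t` has no full class, its other four classes give `D t ≥ 4 + δ y`. With
      -- `D t + D ℓ ≤ 15 + δ y` this forces `D ℓ ≤ 11`.
      ... | no ∄ = ⊥-elim (ℕ.<⇒≱ {16} {17} ℕ.≤-refl (linear 0
          (lower +≤ ℕ.+-monoʳ-≤ (D t) 12≤D +≤ upper) (identity (δ y) (D t) (D ℓ))))
        where
        t : Fin 21
        t = ln y j
        pointwise : ∀ i → 1 + eq j i * δ y ≤ δ (pt t i) + eq j i * 1
        pointwise i with j Fin.≟ i
        ... | yes refl = ℕ.≤-reflexive (trans (cong suc (ℕ.+-identityʳ (δ y)))
          (trans (cong (λ x → suc (δ x)) (sym (pt-ln y j))) (ℕ.+-comm 1 (δ (pt t j)))))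
        ... | no _ = ℕ.≤-trans (ℕ.n≢0⇒n>0 λ δ≡0 → ∄ (i , δ≡0)) (ℕ.m≤m+n (δ (pt t i)) 0)
        lower : 5 + δ y ≤ D t + 1
        lower = subst₂ _≤_
          (trans (∑-distrib-+ (λ _ → 1) (λ i → eq j i * δ y)) (cong₂ _+_ (sum-const 5 1) (sum-eq j λ _ → δ y)))
          (trans (∑-distrib-+ (λ i → δ (pt t i)) (λ i → eq j i * 1)) (cong (D t +_) (sum-eq j λ _ → 1)))
          (sum-mono pointwise)
        upper : D t + D ℓ ≤ 15 + δ y
        upper = subst₂ (λ a b → D t + D ℓ ≤ a + b) total-deficit
          (trans (Δ.shared-meet j k (transversal j j≢k) (pt-ln y j)) (cong δ (pt-ln y j))) (Δ.two-lines t ℓ)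
        identity : ∀ d m l → 17 + (m + 1 + (m + l + (15 + d))) + 0 ≡ 16 + (5 + d + (m + 12 + (m + l)))
        identity = solve-∀

      Σ≡ : 15 + 4 * δ y + 5 ≡ 25 + D ℓ
      Σ≡ = trans (sym (trans (∑-distrib-+ (λ j → D (ln y j)) (λ j → eq k j * 5))
                   (cong₂ _+_ (pencil y) (sum-eq k λ _ → 5))))
             (trans (sum-cong-≗ pointwise)
               (trans (∑-distrib-+ (λ _ → 5) (λ j → eq k j * D ℓ))
                 (cong₂ _+_ (sum-const 5 5) (sum-eq k λ _ → D ℓ))))
        where
        pointwise : ∀ j → D (ln y j) + eq k j * 5 ≡ 5 + eq k j * D ℓ
        pointwise j with k Fin.≟ j
        ... | yes refl = trans (ℕ.+-comm (D (ln y k)) 5)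
                           (cong (5 +_) (trans (cong D ln-y) (sym (ℕ.+-identityʳ (D ℓ)))))
        ... | no k≢j = cong (_+ 0) (five j λ j≡k → k≢j (sym j≡k))

    impossible : ⊥
    impossible with Fin.any? (λ m → 12 ℕ.≤? D m)
    ... | yes (ℓ , 12≤D) = with-long-line ℓ 12≤D
    ... | no ∄ = without-long-line λ m 12≤D → ∄ (m , 12≤D)

  -- Coordinates over F₄

  -- F₄ = {0, 1, ω, ω²} with ω = 2F and ω² = 3F.
  infixl 6 _⊞_
  infixl 7 _⊠_
  opaque
    _⊞_ _⊠_ : Fin 4 → Fin 4 → Fin 4
    a ⊞ b = lookup (lookup
      ( (0F ∷ 1F ∷ 2F ∷ 3F ∷ [])
      ∷ (1F ∷ 0F ∷ 3F ∷ 2F ∷ [])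
      ∷ (2F ∷ 3F ∷ 0F ∷ 1F ∷ [])
      ∷ (3F ∷ 2F ∷ 1F ∷ 0F ∷ []) ∷ []) a) b
    a ⊠ b = lookup (lookup
      ( (0F ∷ 0F ∷ 0F ∷ 0F ∷ [])
      ∷ (0F ∷ 1F ∷ 2F ∷ 3F ∷ [])
      ∷ (0F ∷ 2F ∷ 3F ∷ 1F ∷ [])
      ∷ (0F ∷ 3F ∷ 1F ∷ 2F ∷ []) ∷ []) a) b

  dot : Vec (Fin 4) 3 → Vec (Fin 4) 3 → Fin 4
  dot (a ∷ b ∷ c ∷ []) (x ∷ y ∷ z ∷ []) = a ⊠ x ⊞ (b ⊠ y ⊞ c ⊠ z)

  pattern triple a b c = a ∷ b ∷ c ∷ []

  -- Normalised homogeneous coordinates of the cyclic plane; the points are the powers of a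
  -- root of X³ + X² + X + ω, which generates F₆₄ˣ modulo F₄ˣ.
  opaque
    point : Fin 21 → Vec (Fin 4) 3
    point = lookup (
      triple 1F 0F 0F ∷ triple 0F 1F 0F ∷ triple 0F 0F 1F ∷
      triple 1F 3F 3F ∷ triple 1F 2F 0F ∷ triple 0F 1F 2F ∷
      triple 1F 3F 1F ∷ triple 1F 0F 1F ∷ triple 1F 0F 3F ∷
      triple 1F 2F 3F ∷ triple 1F 2F 1F ∷ triple 1F 0F 2F ∷
      triple 1F 1F 3F ∷ triple 1F 2F 2F ∷ triple 1F 1F 0F ∷
      triple 0F 1F 1F ∷ triple 1F 3F 0F ∷ triple 0F 1F 3F ∷
      triple 1F 3F 2F ∷ triple 1F 1F 2F ∷ triple 1F 1F 1F ∷ []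
      )

    form : Fin 21 → Vec (Fin 4) 3
    form = lookup (
      triple 0F 0F 1F ∷ triple 1F 0F 0F ∷ triple 1F 2F 0F ∷
      triple 1F 3F 1F ∷ triple 1F 3F 2F ∷ triple 0F 1F 3F ∷
      triple 1F 0F 1F ∷ triple 0F 1F 0F ∷ triple 1F 0F 2F ∷
      triple 1F 3F 0F ∷ triple 1F 1F 3F ∷ triple 1F 3F 3F ∷
      triple 1F 2F 1F ∷ triple 1F 1F 2F ∷ triple 1F 1F 1F ∷
      triple 1F 2F 2F ∷ triple 1F 2F 3F ∷ triple 0F 1F 2F ∷
      triple 1F 0F 3F ∷ triple 1F 1F 0F ∷ triple 0F 1F 1F ∷ []
      )

  pivot : Vec (Fin 4) 3 → Fin 3
  pivot (triple (suc _) _ _) = 0F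
  pivot (triple zero (suc _) _) = 1F
  pivot (triple zero zero _) = 2F

  -- The lifts of a point (line) of the plane over F₄ to the Hjelmslev plane are
  -- parametrized by two further coordinates, placed outside the pivot.
  offset : Vec (Fin 4) 3 → Vec (Fin 4) 2 → Vec (Fin 4) 3
  offset v p = insertAt p (pivot v) 0F

  pair : Fin 16 → Vec (Fin 4) 2
  pair q = let a , b = remQuot {4} 4 q in a ∷ b ∷ []

  -- The radical offset of a line enters the incidence equation only through its value at the
  -- underlying point of the plane over F₄, so this value can label the segment cut out.
  c : Fin 21 → Fin 5 → Fin 16 → Fin 4
  c m j q = dot (offset (form m) (pair q)) (point (pt m j))

  minor : Fin 21 → Fin 5 → Fin 4 × Fin 4
  minor m j = minor′ (pivot (form m)) (point (pt m j))
    where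
    minor′ : Fin 3 → Vec (Fin 4) 3 → Fin 4 × Fin 4
    minor′ 0F (triple _ y z) = y , z
    minor′ 1F (triple x _ z) = x , z
    minor′ 2F (triple x y _) = x , y

  linear-form : Fin 4 × Fin 4 → Fin 16 → Fin 4
  linear-form (α , β) q = let a , b = remQuot {4} 4 q in a ⊠ α ⊞ b ⊠ β

  opaque
    unfolding pt ln point form _⊞_

    c-linear : ∀ m j q → c m j q ≡ linear-form (minor m j) q
    c-linear = from-yes (Fin.all? λ m → Fin.all? λ j → Fin.all? λ q → c m j q Fin.≟ linear-form (minor m j) q)

    -- The equation of line `m` recovers the pivot coordinate from the other two, so distinct points
    -- of `m` stay independent when it is dropped.
    minors-independent : ∀ m j k → j ≢ k →
      proj₁ (minor m j) ⊠ proj₂ (minor m k) ≢ proj₂ (minor m j) ⊠ proj₁ (minor m k)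
    minors-independent = from-yes (Fin.all? λ m → Fin.all? λ j → Fin.all? λ k →
      ¬? (j Fin.≟ k) →-dec
      ¬? (proj₁ (minor m j) ⊠ proj₂ (minor m k) Fin.≟ proj₂ (minor m j) ⊠ proj₁ (minor m k)))

    -- Any two points of an affine plane of order 4 are joined by a line.
    some-agreement : ∀ x a b a′ b′ → ∃ λ j →
      dot (form (ln x j)) (offset (point x) (a ∷ b ∷ [])) ≡ dot (form (ln x j)) (offset (point x) (a′ ∷ b′ ∷ []))
    some-agreement = from-yes (Fin.all? λ x → Fin.all? λ a → Fin.all? λ b → Fin.all? λ a′ → Fin.all? λ b′ →
      Fin.any? λ j → dot (form (ln x j)) (offset (point x) (a ∷ b ∷ []))
               Fin.≟ dot (form (ln x j)) (offset (point x) (a′ ∷ b′ ∷ [])))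

    point-1yz : ∀ y z → ∃ λ x → point x ≡ triple 1F y z
    point-1yz = from-yes (Fin.all? λ y → Fin.all? λ z → Fin.any? λ x → Vec.≡-dec Fin._≟_ (point x) (triple 1F y z))

    point-01z : ∀ z → ∃ λ x → point x ≡ triple 0F 1F z
    point-01z = from-yes (Fin.all? λ z → Fin.any? λ x → Vec.≡-dec Fin._≟_ (point x) (triple 0F 1F z))

    point-001 : ∃ λ x → point x ≡ triple 0F 0F 1F
    point-001 = from-yes (Fin.any? λ x → Vec.≡-dec Fin._≟_ (point x) (triple 0F 0F 1F))

    form-pivot : ∀ m → lookup (form m) (pivot (form m)) ≡ 1F
    form-pivot = from-yes (Fin.all? λ m → lookup (form m) (pivot (form m)) Fin.≟ 1F)

  opaque
    unfolding _⊞_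

    -- Two independent linear forms give a bijection of F₄² onto itself, so each pair of values is
    -- taken once.
    forms-orthogonal : ∀ u v → proj₁ u ⊠ proj₂ v ≢ proj₂ u ⊠ proj₁ v → ∀ s t →
      ∑[ q < 16 ] (eq (linear-form u q) s * eq (linear-form v q) t) ≡ 1
    forms-orthogonal (α , β) (α′ , β′) = from-yes (Fin.all? λ α → Fin.all? λ β → Fin.all? λ α′ → Fin.all? λ β′ →
      ¬? (α ⊠ β′ Fin.≟ β ⊠ α′) →-dec (Fin.all? λ s → Fin.all? λ t →
        ∑[ q < 16 ] (eq (linear-form (α , β) q) s * eq (linear-form (α′ , β′) q) t) ℕ.≟ 1)) α β α′ β′

  orthogonal : ∀ m j k → j ≢ k → ∀ s t → ∑[ q < 16 ] (eq (c m j q) s * eq (c m k q) t) ≡ 1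
  orthogonal m j k j≢k s t = trans
    (sum-cong-≗ λ q → cong₂ (λ a b → eq a s * eq b t) (c-linear m j q) (c-linear m k q))
    (forms-orthogonal (minor m j) (minor m k) (minors-independent m j k j≢k) s t)

  opaque
    unfolding _⊞_

    ⊞-cancel : ∀ a b → a ⊞ (b ⊞ (a ⊞ b)) ≡ 0F
    ⊞-cancel = from-yes (Fin.all? λ a → Fin.all? λ b → a ⊞ (b ⊞ (a ⊞ b)) Fin.≟ 0F)

open Combinatorics

-- The three chain rings and their Hjelmslev planes

module _ (R : FiniteRing) where
  open FiniteRing R

  dotᴿ : Carrier × Carrier × Carrier → Carrier × Carrier × Carrier → Carrier
  dotᴿ (a , b , c) (x , y , z) = a * x + (b * y + c * z)

  thicken : (Fin 4 → Carrier) → (Fin 4 → Carrier) → Vec (Fin 4) 3 → Vec (Fin 4) 3 → Carrier × Carrier × Carrier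
  thicken lift rad (triple a b c) (triple p q r) = lift a + rad p , lift b + rad q , lift c + rad r

  lifted : (Fin 4 → Carrier) → Vec (Fin 4) 3 → Carrier × Carrier × Carrier
  lifted lift (triple a b c) = lift a , lift b , lift c

  -- Every element is lift a + rad b, where lift is a section of R → R/rad R = F₄ (not
  -- additive for 𝔾₄) and rad an isomorphism from F₄ onto the radical; τ is the action on
  -- F₄ by which rad fails to be right linear.
  record Coordinates (lift rad : Fin 4 → Carrier) (τ : Fin 4 → Fin 4) : Set where
    field
      lift-0 : lift 0F ≈ 0#
      lift-1 : lift 1F ≈ 1#
      rad-0 : rad 0F ≈ 0#
      rad-1 : ¬ rad 1F ≈ 0#
      rad-+ : ∀ a b → rad a + rad b ≈ rad (a ⊞ b)
      lift-rad : ∀ a b → lift a * rad b ≈ rad (a ⊠ b)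
      rad-lift : ∀ a b → rad (τ a) * lift b ≈ rad (τ (a ⊠ b))
      rad-rad : ∀ a b → rad a * rad b ≈ 0#
      τ-0 : τ 0F ≡ 0F
      τ-⊞ : ∀ a b → τ a ⊞ τ b ≡ τ (a ⊞ b)
      τ-involutive : ∀ a → τ (τ a) ≡ a
      split : ∀ r → ∃₂ λ a b → r ≈ lift a + rad b
      unit : ∀ a b → a ≡ 0F ⊎ ∃₂ λ a′ b′ → (lift a′ + rad b′) * (lift a + rad b) ≈ 1#
      absorb : ∀ a b c → ∃ λ d → rad a * (lift b + rad c) ≈ rad d
      carry : ∀ m j → ∃ λ k → dotᴿ (lifted lift (form m)) (lifted lift (point (pt m j))) ≈ rad k

  opaque
    unfolding pt ln point form _⊞_

    coordinates? : ∀ lift rad τ → Dec (Coordinates lift rad τ)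
    coordinates? lift rad τ = map′
      (λ (a , b , c , d , e , f , g , h , i , j , k , l , m , n , o) → record
        { lift-0 = a ; lift-1 = b ; rad-0 = c ; rad-1 = d ; rad-+ = e ; lift-rad = f ; rad-lift = g
        ; rad-rad = h ; τ-0 = i ; τ-⊞ = j ; τ-involutive = k ; split = l ; unit = m ; absorb = n ; carry = o })
      (λ c → let open Coordinates c in
        lift-0 , lift-1 , rad-0 , rad-1 , rad-+ , lift-rad , rad-lift , rad-rad ,
        τ-0 , τ-⊞ , τ-involutive , split , unit , absorb , carry)
      ((lift 0F ≟ 0#) ×-dec (lift 1F ≟ 1#) ×-dec (rad 0F ≟ 0#) ×-dec ¬? (rad 1F ≟ 0#)
      ×-dec (Fin.all? λ a → Fin.all? λ b → (rad a + rad b) ≟ rad (a ⊞ b))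
      ×-dec (Fin.all? λ a → Fin.all? λ b → (lift a * rad b) ≟ rad (a ⊠ b))
      ×-dec (Fin.all? λ a → Fin.all? λ b → (rad (τ a) * lift b) ≟ rad (τ (a ⊠ b)))
      ×-dec (Fin.all? λ a → Fin.all? λ b → (rad a * rad b) ≟ 0#)
      ×-dec (τ 0F Fin.≟ 0F)
      ×-dec (Fin.all? λ a → Fin.all? λ b → τ a ⊞ τ b Fin.≟ τ (a ⊞ b))
      ×-dec (Fin.all? λ a → τ (τ a) Fin.≟ a)
      ×-dec search⇒all setoid (enumeration⇒searchable setoid enumerates)
              (λ x≈y (a , b , e) → a , b , trans (sym x≈y) e)
              (λ r → Fin.any? λ a → Fin.any? λ b → r ≟ (lift a + rad b))
      ×-dec (Fin.all? λ a → Fin.all? λ b → (a Fin.≟ 0F) ⊎-dec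
              (Fin.any? λ a′ → Fin.any? λ b′ → ((lift a′ + rad b′) * (lift a + rad b)) ≟ 1#))
      ×-dec (Fin.all? λ a → Fin.all? λ b → Fin.all? λ c → Fin.any? λ d → (rad a * (lift b + rad c)) ≟ rad d)
      ×-dec (Fin.all? λ m → Fin.all? λ j → Fin.any? λ k →
              dotᴿ (lifted lift (form m)) (lifted lift (point (pt m j))) ≟ rad k))

lift-𝔾 rad-𝔾 : Fin 4 → FiniteRing.Carrier 𝔾₄
lift-𝔾 = lookup ((0F , 0F) ∷ (1F , 0F) ∷ (0F , 1F) ∷ (1F , 1F) ∷ [])
rad-𝔾  = lookup ((0F , 0F) ∷ (2F , 0F) ∷ (0F , 2F) ∷ (2F , 2F) ∷ [])

𝔽₄ : Fin 4 → CommutativeRing.Carrier F₄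
𝔽₄ = lookup ((0F , 0F) ∷ (1F , 0F) ∷ (0F , 1F) ∷ (1F , 1F) ∷ [])

lift-𝔽 rad-𝔽 : Fin 4 → CommutativeRing.Carrier F₄ × CommutativeRing.Carrier F₄
lift-𝔽 a = 𝔽₄ a , 𝔽₄ 0F
rad-𝔽  a = 𝔽₄ 0F , 𝔽₄ a

opaque
  unfolding coordinates? _⊞_

  coordinates-𝔾₄ : Coordinates 𝔾₄ lift-𝔾 rad-𝔾 id
  coordinates-𝔾₄ = from-yes (coordinates? 𝔾₄ lift-𝔾 rad-𝔾 id)

  coordinates-𝕊₄ : Coordinates 𝕊₄ lift-𝔽 rad-𝔽 id
  coordinates-𝕊₄ = from-yes (coordinates? 𝕊₄ lift-𝔽 rad-𝔽 id)

  coordinates-𝕋₄ : Coordinates 𝕋₄ lift-𝔽 rad-𝔽 (λ a → a ⊠ a)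
  coordinates-𝕋₄ = from-yes (coordinates? 𝕋₄ lift-𝔽 rad-𝔽 (λ a → a ⊠ a))

-- Decidable subsets and their cardinality

module _ {n} {P : Fin n → Set} (P? : ∀ i → Dec (P i)) where

  subset : Subset n
  subset = tabulate λ i → does (P? i)

  ∈-subset : ∀ {i} → i ∈ subset → P i
  ∈-subset {i} i∈S with P? i | ≡.trans (≡.sym (Vec.lookup∘tabulate (λ i → does (P? i)) i)) (Vec.[]=⇒lookup i∈S)
  ... | yes p | _ = p

≤-indicator : ∀ {A : Set} {k} (a? : Dec A) → k ≤ 1 → (¬ A → k ≡ 0) → k ≤ (if does a? then 1 else 0)
≤-indicator (yes _) k≤1 _   = k≤1
≤-indicator (no ¬a) _   k≡0 = ℕ.≤-reflexive (k≡0 ¬a)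

sum-indicator : ∀ {n} {P : Fin n → Set} (P? : ∀ i → Dec (P i)) →
                ∑[ i < n ] (if does (P? i) then 1 else 0) ≡ ∣ subset P? ∣
sum-indicator {zero}  P? = ≡.refl
sum-indicator {suc n} P? with does (P? zero)
... | true  = cong suc (sum-indicator λ i → P? (suc i))
... | false = sum-indicator λ i → P? (suc i)

-- Points and lines of the Hjelmslev plane in coordinates

module Geometry (R : FiniteRing) {lift rad : Fin 4 → FiniteRing.Carrier R} {τ : Fin 4 → Fin 4}
  (coordinates : Coordinates R lift rad τ) where

  open FiniteRing R
  open PHG ring
  open ArcSearch R
  open RightModule R³ using (Carrierᴹ; _≈ᴹ_; _*ᵣ_; ≈ᴹ-sym; ≈ᴹ-trans; +ᴹ-identityʳ)
  open Coordinates coordinates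
  open RingProperties ring using (-‿distribˡ-*; -‿+-comm)
  open GroupProperties +-group using (inverseˡ-unique)
  open CommutativeMonoidSolver +-commutativeMonoid using (solve; _⊜_; _⊕_)
  open import Relation.Binary.Reasoning.Setoid setoid

  _∙_ : Carrierᴹ → Carrierᴹ → Carrier
  _∙_ = dotᴿ R

  thick : Vec (Fin 4) 3 → Vec (Fin 4) 3 → Carrierᴹ
  thick = thicken R lift rad

  coordinate : Fin 3 → Carrierᴹ → Carrier
  coordinate 0F (x , _ , _) = x
  coordinate 1F (_ , y , _) = y
  coordinate 2F (_ , _ , z) = z

  private
    select₁ : ∀ r s → 1# * r + (0# * s + 0#) ≈ r
    select₁ r s = trans (+-cong (*-identityˡ r) (trans (+-identityʳ _) (zeroˡ s))) (+-identityʳ r)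

    select₂ : ∀ r s → 0# * r + (1# * s + 0#) ≈ s
    select₂ r s = trans (+-cong (zeroˡ r) (trans (+-identityʳ _) (*-identityˡ s))) (+-identityˡ s)

    negated : ∀ a b r s → - a * r + (- b * s + 0#) ≈ - (a * r + b * s)
    negated a b r s = trans
      (+-cong (sym (-‿distribˡ-* a r)) (trans (+-identityʳ _) (sym (-‿distribˡ-* b s))))
      (-‿+-comm (a * r) (b * s))

    isolate : ∀ {e x y} → e ≈ 1# → e * x + y ≈ 0# → x ≈ - y
    isolate {e} {x} {y} e≈1 eq = inverseˡ-unique x y
      (trans (+-congʳ (trans (sym (*-identityˡ x)) (*-congʳ (sym e≈1)))) eq)

  -- The equation `h ∙ v ≈ 0#` expresses coordinate `k` of `v` through the other two, which serve as
  -- the coefficients with respect to the chosen basis.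
  kernel : ∀ k h → coordinate k h ≈ 1# → ∃ λ (L : Line) → ∀ v → h ∙ v ≈ 0# → ⟦ L ⟧ v
  kernel 0F (e , a , b) e≈1 = spanned basis independent , λ (x , y , z) eq →
      (λ { 0F → y ; 1F → z }) ,
      trans (isolate e≈1 eq) (sym (negated a b y z)) , sym (select₁ y z) , sym (select₂ y z)
    where
    basis : Fin 2 → Carrierᴹ
    basis 0F = - a , 1# , 0#
    basis 1F = - b , 0# , 1#
    independent : LinearlyIndependent basis
    independent r (_ , p , q) 0F = trans (sym (select₁ (r 0F) (r 1F))) p
    independent r (_ , p , q) 1F = trans (sym (select₂ (r 0F) (r 1F))) q
  kernel 1F (a , e , b) e≈1 = spanned basis independent , λ (x , y , z) eq →
      (λ { 0F → x ; 1F → z }) , sym (select₁ x z) ,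
      trans (isolate e≈1 (trans (swap (e * y) (a * x) (b * z)) eq)) (sym (negated a b x z)) ,
      sym (select₂ x z)
    where
    swap : ∀ p q r → p + (q + r) ≈ q + (p + r)
    swap = solve 3 (λ p q r → (p ⊕ (q ⊕ r)) ⊜ (q ⊕ (p ⊕ r))) refl
    basis : Fin 2 → Carrierᴹ
    basis 0F = 1# , - a , 0#
    basis 1F = 0# , - b , 1#
    independent : LinearlyIndependent basis
    independent r (p , _ , q) 0F = trans (sym (select₁ (r 0F) (r 1F))) p
    independent r (p , _ , q) 1F = trans (sym (select₂ (r 0F) (r 1F))) q
  kernel 2F (a , b , e) e≈1 = spanned basis independent , λ (x , y , z) eq →
      (λ { 0F → x ; 1F → y }) , sym (select₁ x y) , sym (select₂ x y) ,
      trans (isolate e≈1 (trans (rotate (e * z) (a * x) (b * y)) eq)) (sym (negated a b x y))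
    where
    rotate : ∀ p q r → p + (q + r) ≈ q + (r + p)
    rotate = solve 3 (λ p q r → (p ⊕ (q ⊕ r)) ⊜ (q ⊕ (r ⊕ p))) refl
    basis : Fin 2 → Carrierᴹ
    basis 0F = 1# , 0# , - a
    basis 1F = 0# , 1# , - b
    independent : LinearlyIndependent basis
    independent r (p , q , _) 0F = trans (sym (select₁ (r 0F) (r 1F))) p
    independent r (p , q , _) 1F = trans (sym (select₂ (r 0F) (r 1F))) q

  -- Twisting line offsets by `τ` turns `rad-lift` into multiplication in F₄ followed by `τ`, so the
  -- same array `c` serves all three rings.
  rad-τ : Vec (Fin 4) 3 → Vec (Fin 4) 3
  rad-τ = Vec.map τ

  dot-thick : ∀ h q v p → thick h (rad-τ q) ∙ thick v p
            ≈ (lifted R lift h ∙ lifted R lift v) + (rad (dot h p) + rad (τ (dot q v)))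
  dot-thick (triple h₁ h₂ h₃) (triple q₁ q₂ q₃) (triple v₁ v₂ v₃) (triple p₁ p₂ p₃) = begin
    (thick h (rad-τ q) ∙ thick v p)
      ≈⟨ +-cong (product h₁ q₁ v₁ p₁) (+-cong (product h₂ q₂ v₂ p₂) (product h₃ q₃ v₃ p₃)) ⟩
    _ ≈⟨ regroup _ _ _ _ _ _ _ _ _ ⟩
    (lifted R lift h ∙ lifted R lift v)
      + ((rad (h₁ ⊠ p₁) + (rad (h₂ ⊠ p₂) + rad (h₃ ⊠ p₃)))
      + (rad (τ (q₁ ⊠ v₁)) + (rad (τ (q₂ ⊠ v₂)) + rad (τ (q₃ ⊠ v₃)))))
      ≈⟨ +-congˡ (+-cong (sum-rad _ _ _) (trans (sum-rad _ _ _) (reflexive (cong rad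
           (≡.trans (cong (τ (q₁ ⊠ v₁) ⊞_) (τ-⊞ _ _)) (τ-⊞ _ _)))))) ⟩
    (lifted R lift h ∙ lifted R lift v) + (rad (dot h p) + rad (τ (dot q v))) ∎
    where
    h q v p : Vec (Fin 4) 3
    h = triple h₁ h₂ h₃
    q = triple q₁ q₂ q₃
    v = triple v₁ v₂ v₃
    p = triple p₁ p₂ p₃
    product : ∀ h q v p → (lift h + rad (τ q)) * (lift v + rad p)
            ≈ lift h * lift v + (rad (h ⊠ p) + rad (τ (q ⊠ v)))
    product h q v p = begin
      (lift h + rad (τ q)) * (lift v + rad p)
        ≈⟨ trans (distribʳ _ _ _) (+-cong (distribˡ _ _ _) (distribˡ _ _ _)) ⟩
      (lift h * lift v + lift h * rad p) + (rad (τ q) * lift v + rad (τ q) * rad p)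
        ≈⟨ +-cong (+-congˡ (lift-rad h p))
             (trans (+-cong (rad-lift q v) (rad-rad (τ q) p)) (+-identityʳ _)) ⟩
      (lift h * lift v + rad (h ⊠ p)) + rad (τ (q ⊠ v))
        ≈⟨ +-assoc _ _ _ ⟩
      lift h * lift v + (rad (h ⊠ p) + rad (τ (q ⊠ v))) ∎
    regroup : ∀ a b c d e f g h i →
      (a + (d + g)) + ((b + (e + h)) + (c + (f + i))) ≈ (a + (b + c)) + ((d + (e + f)) + (g + (h + i)))
    regroup = solve 9 (λ a b c d e f g h i →
      ((a ⊕ (d ⊕ g)) ⊕ ((b ⊕ (e ⊕ h)) ⊕ (c ⊕ (f ⊕ i)))) ⊜
      ((a ⊕ (b ⊕ c)) ⊕ ((d ⊕ (e ⊕ f)) ⊕ (g ⊕ (h ⊕ i))))) refl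
    sum-rad : ∀ a b c → rad a + (rad b + rad c) ≈ rad (a ⊞ (b ⊞ c))
    sum-rad a b c = trans (+-congˡ (rad-+ b c)) (rad-+ a (b ⊞ c))

  -- The product of the lifts of an incident line and point lies in the radical. It can be nonzero
  -- for 𝔾₄, where `lift` is not additive.
  κ : Fin 21 → Fin 5 → Fin 4
  κ m j = proj₁ (carry m j)

  V : Fin 21 → Vec (Fin 4) 2 → Carrierᴹ
  V x p = thick (point x) (offset (point x) p)

  H : Fin 21 → Fin 16 → Carrierᴹ
  H m q = thick (form m) (rad-τ (offset (form m) (pair q)))

  -- With `s` the dot product below, a line with value `t` at the point contains the lift when
  -- `κ ⊞ s ⊞ τ t = 0`. In characteristic 2 and with `τ` an involution, the solution is
  -- `t = τ (κ ⊞ s)`.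
  segment : Fin 21 → Vec (Fin 4) 2 → Fin 21 → Fin 5 → Fin 4
  segment x p m j = τ (κ m j ⊞ dot (form m) (offset (point x) p))

  incident : ∀ m j q p → segment (pt m j) p m j ≡ c m j q → (H m q ∙ V (pt m j) p) ≈ 0#
  incident m j q p eq = begin
    (H m q ∙ V (pt m j) p)
      ≈⟨ dot-thick (form m) (offset (form m) (pair q)) (point (pt m j)) (offset (point (pt m j)) p) ⟩
    (lifted R lift (form m) ∙ lifted R lift (point (pt m j))) + (rad s + rad (τ (c m j q)))
      ≈⟨ +-cong (proj₂ (carry m j)) (rad-+ s (τ (c m j q))) ⟩
    rad (κ m j) + rad (s ⊞ τ (c m j q))
      ≈⟨ rad-+ (κ m j) (s ⊞ τ (c m j q)) ⟩
    rad (κ m j ⊞ (s ⊞ τ (c m j q)))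
      ≡⟨ cong (λ t → rad (κ m j ⊞ (s ⊞ t))) (≡.trans (cong τ (≡.sym eq)) (τ-involutive (κ m j ⊞ s))) ⟩
    rad (κ m j ⊞ (s ⊞ (κ m j ⊞ s)))
      ≡⟨ cong rad (⊞-cancel (κ m j) s) ⟩
    rad 0F
      ≈⟨ rad-0 ⟩
    0# ∎
    where
    s : Fin 4
    s = dot (form m) (offset (point (pt m j)) p)

  thick-pivot : ∀ k u q → lookup u k ≡ 1F → lookup q k ≡ 0F → coordinate k (thick u (rad-τ q)) ≈ 1#
  thick-pivot k u q u≡1 q≡0 = trans (reflexive (coordinate-thick k u q))
    (trans (+-cong (trans (reflexive (cong lift u≡1)) lift-1)
      (trans (reflexive (cong rad (≡.trans (cong τ q≡0) τ-0))) rad-0)) (+-identityʳ 1#))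
    where
    coordinate-thick : ∀ k u q → coordinate k (thick u (rad-τ q)) ≡ lift (lookup u k) + rad (τ (lookup q k))
    coordinate-thick 0F (triple _ _ _) (triple _ _ _) = ≡.refl
    coordinate-thick 1F (triple _ _ _) (triple _ _ _) = ≡.refl
    coordinate-thick 2F (triple _ _ _) (triple _ _ _) = ≡.refl

  line : ∀ m q → ∃ λ (L : Line) → ∀ v → (H m q ∙ v) ≈ 0# → ⟦ L ⟧ v
  line m q = kernel (pivot (form m)) (H m q) (thick-pivot (pivot (form m)) (form m) _
    (form-pivot m) (Vec.insertAt-lookup (pair q) (pivot (form m)) 0F))

  on-line : (P : Point) (L : Line) → ∀ {v r} → IsFreeOfRank.basis (proj₂ P) 0F ≈ᴹ v *ᵣ r →
            ⟦ L ⟧ v → ⟦ P ⟧ ⊆ ⟦ L ⟧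
  on-line (_ , free) (L , _) {v} {r} b≈vr v∈L u∈P = let s , u≈ = proj₁ (IsFreeOfRank.spanning free) u∈P in
    respects (≈ᴹ-sym (≈ᴹ-trans u≈ (+ᴹ-identityʳ _)))
      (*ᵣ-closed (s 0F) (respects (≈ᴹ-sym b≈vr) (*ᵣ-closed r v∈L)))
    where open Submodule L

  -- Some coordinate of the basis vector is invertible. Factoring out the first such coordinate on
  -- the right leaves 1 in its place and radical elements before it, which is the form of some
  -- `V x p`.
  locate : (P : Point) → ∃ λ x → ∃ λ p → ∃ λ r → IsFreeOfRank.basis (proj₂ P) 0F ≈ᴹ V x p *ᵣ r
  locate (_ , free) = search (classify b₀) (classify b₁) (classify b₂)
    where
    open IsFreeOfRank free
    b₀ b₁ b₂ : Carrier
    b₀ = proj₁ (basis 0F)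
    b₁ = proj₁ (proj₂ (basis 0F))
    b₂ = proj₂ (proj₂ (basis 0F))

    Located : Set
    Located = ∃ λ x → ∃ λ p → ∃ λ r → basis 0F ≈ᴹ V x p *ᵣ r

    Radical Invertible : Carrier → Set
    Radical r = ∃ λ a → r ≈ rad a
    Invertible r = ∃ λ s → s * r ≈ 1#

    classify : ∀ r → Radical r ⊎ Invertible r
    classify r with split r
    ... | a , b , r≈ with unit a b
    ...   | inj₁ a≡0 = inj₁ (b , trans r≈
            (trans (+-congʳ (trans (reflexive (cong lift a≡0)) lift-0)) (+-identityˡ _)))
    ...   | inj₂ (a′ , b′ , e) = inj₂ (lift a′ + rad b′ , trans (*-congˡ r≈) e)

    divided : ∀ b {s r t} → s * r ≈ 1# → b * s ≈ t → b ≈ t * r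
    divided b {s} {r} sr≈1 bs≈t = trans (sym (trans (*-congˡ sr≈1) (*-identityʳ b)))
      (trans (sym (*-assoc b s r)) (*-congʳ bs≈t))

    one : ∀ r → r ≈ (lift 1F + rad 0F) * r
    one r = trans (sym (*-identityˡ r)) (*-congʳ (sym (trans (+-cong lift-1 rad-0) (+-identityʳ 1#))))

    zero-rad : ∀ {r} a → r ≈ rad a → r ≈ lift 0F + rad a
    zero-rad a r≈ = trans r≈ (sym (trans (+-congʳ lift-0) (+-identityˡ (rad a))))

    rad-divided : ∀ {b s} → Radical b → Invertible s → ∃ λ a → b ≈ (lift 0F + rad a) * s
    rad-divided {b} (a , b≈) (t , ts≈1) = let c , d , t≈ = split t ; e , ae≈ = absorb a c d in
      e , divided b ts≈1 (zero-rad e (trans (*-cong b≈ t≈) ae≈))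

    at : ∀ {x v} p r → point x ≡ v → basis 0F ≈ᴹ thick v (offset v p) *ᵣ r → Located
    at {x} p r ≡.refl b≈ = x , p , r , b≈

    search : Radical b₀ ⊎ Invertible b₀ → Radical b₁ ⊎ Invertible b₁ → Radical b₂ ⊎ Invertible b₂ → Located
    search (inj₂ (s , sb≈1)) _ _ =
      let y , p₁ , b₁s≈ = split (b₁ * s) ; z , p₂ , b₂s≈ = split (b₂ * s) in
      at (p₁ ∷ p₂ ∷ []) b₀ (proj₂ (point-1yz y z)) (one b₀ , divided b₁ sb≈1 b₁s≈ , divided b₂ sb≈1 b₂s≈)
    search (inj₁ r₀) (inj₂ u₁@(s , sb≈1)) _ =
      let p₁ , b₀≈ = rad-divided r₀ u₁ ; z , p₂ , b₂s≈ = split (b₂ * s) in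
      at (p₁ ∷ p₂ ∷ []) b₁ (proj₂ (point-01z z)) (b₀≈ , one b₁ , divided b₂ sb≈1 b₂s≈)
    search (inj₁ r₀) (inj₁ r₁) (inj₂ u₂) =
      let p₁ , b₀≈ = rad-divided r₀ u₂ ; p₂ , b₁≈ = rad-divided r₁ u₂ in
      at (p₁ ∷ p₂ ∷ []) b₂ (proj₂ point-001) (b₀≈ , b₁≈ , one b₂)
    -- If all coordinates were radical, the nonzero scalar `rad 1F` would annihilate the basis
    -- vector.
    search (inj₁ r₀) (inj₁ r₁) (inj₁ r₂) = contradiction
      (independent (λ _ → rad 1F) (killed r₀ , killed r₁ , killed r₂) 0F) rad-1
      where
      killed : ∀ {b} → Radical b → b * rad 1F + 0# ≈ 0#
      killed (a , b≈) = trans (+-identityʳ _) (trans (*-congʳ b≈) (rad-rad a 1F))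

  agreement : ∀ x (p p′ : Vec (Fin 4) 2) → ∃ λ j → segment x p (ln x j) j ≡ segment x p′ (ln x j) j
  agreement x (a ∷ b ∷ []) (a′ ∷ b′ ∷ []) = let j , e = some-agreement x a b a′ b′ in
    j , cong (λ t → τ (κ (ln x j) j ⊞ t)) e

  no-arc : ∀ {N} → N ≡ 69 → ¬ ProjectiveArc N 5
  no-arc {N} N≡69 (K , arc) = Arc.impossible c orthogonal n w segments-partition
    (≡.trans classes-partition N≡69) (agreements agree) bound
    where
    cls : Fin N → Fin 21
    cls i = proj₁ (locate (K i))

    position : Fin N → Vec (Fin 4) 2
    position i = proj₁ (proj₂ (locate (K i)))

    seg : Fin N → Fin 5 → Fin 4
    seg i j = segment (cls i) (position i) (ln (cls i) j) j

    open Counts cls seg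

    agree : ∀ i i′ → i ≢ i′ → cls i ≡ cls i′ → ∃ λ j → seg i j ≡ seg i′ j
    agree i i′ _ e = let j , same = agreement (cls i) (position i) (position i′) in
      j , ≡.trans same (cong (λ x → segment x (position i′) (ln x j) j) e)

    Through : Fin 21 → Fin 16 → Fin N → Set
    Through m q i = ∃ λ j → cls i ≡ pt m j × seg i j ≡ c m j q

    through? : ∀ m q i → Dec (Through m q i)
    through? m q i = Fin.any? λ j → (cls i Fin.≟ pt m j) ×-dec (seg i j Fin.≟ c m j q)

    through⇒⊆ : ∀ m q i → Through m q i → ⟦ K i ⟧ ⊆ ⟦ proj₁ (line m q) ⟧
    through⇒⊆ m q i (j , cls≡ , seg≡) = on-line (K i) (proj₁ (line m q)) (proj₂ (proj₂ (proj₂ (locate (K i)))))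
      (proj₂ (line m q) (V (cls i) (position i)) (subst (λ x → (H m q ∙ V x (position i)) ≈ 0#) (≡.sym cls≡)
        (incident m j q (position i) (≡.trans (≡.sym moved) seg≡))))
      where
      moved : seg i j ≡ segment (pt m j) (position i) m j
      moved = ≡.trans (cong (λ x → segment x (position i) (ln x j) j) cls≡)
        (cong (λ l → segment (pt m j) (position i) l j) (ln-pt m j))

    -- After exchanging the sums, each point of K counts at most once, because its class occurs at
    -- most once on `m`, and counts only if it lies on the line. The arc condition applies to the
    -- set of these points.
    bound : ∀ m q → ∑[ j < 5 ] n (pt m j) j (c m j q) ≤ 5
    bound m q = ℕ.≤-trans (ℕ.≤-reflexive (∑-comm λ j i → term i j))
      (ℕ.≤-trans (sum-mono counted) (ℕ.≤-trans (ℕ.≤-reflexive (sum-indicator (through? m q)))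
        (IsProjectiveArc.meets arc (proj₁ (line m q)) (subset (through? m q))
          λ i i∈S → through⇒⊆ m q i (∈-subset (through? m q) i∈S))))
      where
      term : Fin N → Fin 5 → ℕ
      term i j = eq (cls i) (pt m j) ℕ.* eq (seg i j) (c m j q)
      once : ∀ i → sum (term i) ≤ 1
      once i = ℕ.≤-trans (sum-mono λ j → factor j) (incidence≤1 m (cls i))
        where
        eq≤1 : ∀ (s t : Fin 4) → eq s t ≤ 1
        eq≤1 s t with s Fin.≟ t
        ... | yes _ = ℕ.≤-refl
        ... | no  _ = z≤n
        factor : ∀ j → term i j ≤ eq (pt m j) (cls i)
        factor j = ℕ.≤-trans (ℕ.*-monoʳ-≤ (eq (cls i) (pt m j)) (eq≤1 (seg i j) (c m j q)))
          (ℕ.≤-reflexive (≡.trans (ℕ.*-identityʳ _) (eq-sym (cls i) (pt m j))))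
      none : ∀ i → ¬ Through m q i → sum (term i) ≡ 0
      none i ∄ = sum-zero λ j → vanish j
        where
        vanish : ∀ j → term i j ≡ 0
        vanish j with cls i Fin.≟ pt m j | seg i j Fin.≟ c m j q
        ... | no _  | _     = ≡.refl
        ... | yes _ | no _  = ≡.refl
        ... | yes p | yes r = contradiction (j , p , r) ∄
      counted : ∀ i → sum (term i) ≤ (if does (through? m q i) then 1 else 0)
      counted i = ≤-indicator (through? m q i) (once i) (none i)

  fewer-points : ∀ d {k} → ProjectiveArc (d ℕ.+ k) 5 → ProjectiveArc k 5
  fewer-points zero    arc = arc
  fewer-points (suc d) (K , arc) = fewer-points d ((λ i → K (suc i)) , record
    { distinct = λ i j e → Fin.suc-injective (distinct (suc i) (suc j) e)
    ; meets = λ L S on → meets L (outside ∷ S) λ { (suc i) (Vec.there i∈S) → on i i∈S }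
    })
    where open IsProjectiveArc arc

  arc-size : ∀ k → ProjectiveArc k 5 → k ≤ 68
  arc-size k arc = ℕ.≮⇒≥ λ 69≤k → no-arc ≡.refl
    (fewer-points (k ℕ.∸ 69) (subst (λ k → ProjectiveArc k 5) (≡.sym (ℕ.m∸n+n≡m 69≤k)) arc))

largest : ∀ R {lift rad τ} → Coordinates R lift rad τ → m 5 R ≤ 68
largest R coordinates = Geometry.arc-size R coordinates (m 5 R) (proj₁ (proj₂ (ArcSearch.largestArc R 5)))

theorem4p14 : m 5 𝔾₄ ≤ 68 × m 5 𝕊₄ ≤ 68 × m 5 𝕋₄ ≤ 68
theorem4p14 = largest 𝔾₄ coordinates-𝔾₄ , largest 𝕊₄ coordinates-𝕊₄ , largest 𝕋₄ coordinates-𝕋₄
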